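{- Fix $n\ge1$. Partition the set of 3-periodic dissections of the convex $(n+2)$-gon into classes of dissections having the same quiddity. Every such class contains exactly one maximally open 3-periodic dissection.
   Context: Fix a convex $(n+2)$-gon with vertices labelled $0,1,\dots,n+1$ in counterclockwise cyclic order; its edges are $(i,i+1)$, $i\in\mathbb Z/(n+2)$, and its base edge is $(n+1,0)$. A dissection is a set of pairwise non-crossing diagonals (chords), partitioning the polygon into cells; the sides of a cell are the edges and chords bounding it. The quiddity of a dissection is $(a_0,\dots,a_{n+1})$ with $a_i$ the number of cells having vertex $i$. A dissection is 3-periodic if every cell has a number of vertices divisible by 3. The base cell is the cell containing the base edge. For a cell with vertices $0\le v_0<\dots<v_{r+1}\le n+1$, its sides are $(v_s,v_{s+1})$, $0\le s\le r+1$, with $v_{r+2}:=v_0$, and its base side is $(v_{r+1},v_0)$. The parent of a non-base cell is the other cell containing its base side; the level of a cell is its number of iterated parents. $\mathbb Z_3$-index: recursively on level, the base edge has index $0$, and if a cell's base side has index $c$ then its side $(v_s,v_{s+1})$ has index $c+s+1\bmod3$ for $0\le s\le r$. Sides $(v_s,v_{s+1}),(v_{s'},v_{s'+1})$, $s<s'$, of a cell are distant if $s'\ge s+3$ and $s\ge s'+3-(r+2)$. A 3-periodic opening surgery on a cell is the replacement of its base side and another side distant from it, both being chords of the same $\mathbb Z_3$-index, say $(v_s,v_{s+1})$ and $(v_{s'},v_{s'+1})$, by the chords $(v_{s+1},v_{s'})$ and $(v_{s'+1},v_s)$. A cell is maximally open if it admits no 3-periodic opening surgery; a 3-periodic dissection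 is maximally open if all its cells are. -}

module Defs where

open import Data.Bool using (Bool; true; false; _∧_; _∨_; not; T)
open import Data.Nat using (ℕ; zero; suc; _+_; _∸_; _<_; _≤_; _≡ᵇ_; _<ᵇ_; _%_)
open import Data.Nat.Divisibility using (_∣_)
open import Data.Product using (_×_; _,_; Σ; ∃)
open import Data.List using (List; []; _∷_; map; _++_; length; upTo)
open import Data.Bool.ListAction using (any; all)
open import Data.List.Membership.Propositional using (_∈_)
open import Data.List.Relation.Unary.All using (All)
open import Relation.Binary.PropositionalEquality using (_≡_; _≢_)
open import Relation.Nullary using (¬_)
open import Function.Bundles using (_⇔_)

-- The convex (n+2)-gon has vertices 0,1,…,n+1 (natural numbers ≤ n+1).
-- A chord (diagonal) is stored as a pair (i , j) with i < j, not an edge.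

IsChord : ℕ → ℕ × ℕ → Set
IsChord n (i , j) = (suc i < j) × (j ≤ suc n) × ¬ ((i ≡ 0) × (j ≡ suc n))

-- Two chords (a,b) and (c,d) cross iff a < c < b < d (the symmetric case
-- is covered by quantifying over both orders).
Crosses : ℕ × ℕ → ℕ × ℕ → Set
Crosses (a , b) (c , d) = (a < c) × (c < b) × (b < d)

-- A dissection: a (finite) set of pairwise non-crossing chords,
-- represented by a list (only its membership relation matters).
record Dissection (n : ℕ) : Set where
  field
    chords   : List (ℕ × ℕ)
    valid    : All (IsChord n) chords
    noncross : ∀ {p q} → p ∈ chords → q ∈ chords → ¬ Crosses p q
open Dissection public

SameChords : ∀ {n} → Dissection n → Dissection n → Set
SameChords D E = ∀ p → (p ∈ chords D) ⇔ (p ∈ chords E)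

membᵇ : ℕ × ℕ → List (ℕ × ℕ) → Bool
membᵇ (a , b) = any (λ { (c , d) → (a ≡ᵇ c) ∧ (b ≡ᵇ d) })

elemᵇ : ℕ → List ℕ → Bool
elemᵇ i = any (λ j → i ≡ᵇ j)

filterᵇ : {A : Set} → (A → Bool) → List A → List A
filterᵇ p [] = []
filterᵇ p (x ∷ xs) with p x
... | true  = x ∷ filterᵇ p xs
... | false = filterᵇ p xs

-- all sublists (as ordered subsequences); applied to upTo (n+2) this
-- gives every strictly increasing list of vertices.
sublists : {A : Set} → List A → List (List A)
sublists [] = [] ∷ []
sublists (x ∷ xs) = map (x ∷_) (sublists xs) ++ sublists xs

at : List ℕ → ℕ → ℕ
at []       _       = 0
at (x ∷ xs) zero    = x
at (x ∷ xs) (suc s) = at xs s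

-- Cells.  A cell with vertices v₀ < … < v_{r+1} (r ≥ 1) is a convex
-- polygon all of whose sides (v_s , v_{s+1}), 0 ≤ s ≤ r, and
-- (v₀ , v_{r+1}) are edges of the (n+2)-gon or chords of D, and which
-- contains no chord of D in its interior, i.e. no diagonal (v_i , v_j)
-- of the cell is a chord of D.  (Since D is non-crossing these are
-- exactly the regions of the partition of the polygon by D.)

module _ {n : ℕ} (D : Dissection n) where

  isSideᵇ : ℕ → ℕ → Bool
  isSideᵇ a b = (b ≡ᵇ suc a) ∨ membᵇ (a , b) (chords D)

  isCellᵇ : List ℕ → Bool
  isCellᵇ vs =
    (2 <ᵇ k)
    ∧ all (λ s → not (suc s <ᵇ k) ∨ isSideᵇ (at vs s) (at vs (suc s))) (upTo k)
    ∧ (((at vs 0 ≡ᵇ 0) ∧ (at vs (k ∸ 1) ≡ᵇ suc n))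
        ∨ membᵇ (at vs 0 , at vs (k ∸ 1)) (chords D))
    ∧ all (λ i → all (λ j → noDiag i j) (upTo k)) (upTo k)
    where
    k : ℕ
    k = length vs
    noDiag : ℕ → ℕ → Bool
    noDiag i j = not ((suc i <ᵇ j) ∧ (j <ᵇ k) ∧ not ((i ≡ᵇ 0) ∧ (j ≡ᵇ k ∸ 1)))
                 ∨ not (membᵇ (at vs i , at vs j) (chords D))

  cells : List (List ℕ)
  cells = filterᵇ isCellᵇ (sublists (upTo (suc (suc n))))

  quiddity : List ℕ
  quiddity = map (λ i → length (filterᵇ (elemᵇ i) cells)) (upTo (suc (suc n)))

  ThreePeriodic : Set
  ThreePeriodic = All (λ C → 3 ∣ length C) cells

side : List ℕ → ℕ → ℕ × ℕ
side C s = (at C s , at C (suc s))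

-- base side (v_{r+1} , v₀), stored as the ordered pair (v₀ , v_{r+1})
baseSide : List ℕ → ℕ × ℕ
baseSide C = (at C 0 , at C (length C ∸ 1))

module _ {n : ℕ} (D : Dissection n) where

  data Idx : ℕ × ℕ → ℕ → Set where
    base : Idx (0 , suc n) 0
    step : ∀ {C c s} → C ∈ cells D → Idx (baseSide C) c →
           s < length C ∸ 1 → Idx (side C s) ((c + s + 1) % 3)

  -- sides s < s' of a cell with r+2 vertices are distant
  Distant : ℕ → ℕ → ℕ → Set
  Distant r s s' = (s + 3 ≤ s') × (s' + 3 ≤ s + (r + 2))

  -- C admits a 3-periodic opening surgery: its base side (side number r+1)
  -- and a side s distant from it are both chords of D with equal Z₃-index.
  AdmitsSurgery : List ℕ → Set
  AdmitsSurgery C =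
    Σ ℕ λ s → (s < r + 1) × Distant r s (r + 1)
      × (baseSide C ∈ chords D) × (side C s ∈ chords D)
      × ∃ λ c → Idx (baseSide C) c × Idx (side C s) c
    where r = length C ∸ 2

  MaximallyOpen : Set
  MaximallyOpen = ThreePeriodic D × All (λ C → ¬ AdmitsSurgery C) (cells D)

{-# OPTIONS --safe #-}
module Submission where

-- A dissection is a plane forest: the children of a cell are its non-base sides, an edge being
-- a leaf and a chord carrying the cell behind it.  Record the boundary as a word, writing one
-- letter for an edge and another letter for a chord end, without telling left ends from right
-- ends.  Vertex i lies on one more cell than there are chords ending at i, so the quiddity and
-- the word determine each other.  Opening a cell turns "( A ( B ) C )" into "( A ) B ( C )",
-- which has the same word.  In a 3-periodic dissection the side s of a cell has the index of
-- the base side iff s ≡ 2 mod 3; hence in a maximally open one a chord end met inside a non-base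
-- cell after s sides is a right end if s ≡ 2 mod 3 and a left end otherwise, so the word can be
-- parsed in one way only.

open import Defs
open import Data.Bool using (Bool; true; false; T; not; _∧_; _∨_)
open import Data.Bool.Properties using (T-∧; T-∨; T?)
open import Data.Empty using (⊥; ⊥-elim)
open import Data.List using (List; []; _∷_; map; _++_; length; upTo; applyUpTo; filter)
open import Data.List.Membership.Propositional using (_∈_)
open import Data.List.Membership.Propositional.Properties using (∈-++⁺ˡ; ∈-++⁺ʳ; ∈-++⁻; ∈-map⁺; ∈-map⁻; ∈-filter⁺; ∈-filter⁻)
open import Data.List.Membership.Propositional.Properties.WithK using (unique∧set⇒bag)
open import Data.List.Properties using (∷-injectiveˡ; ∷-injectiveʳ; ++-assoc; map-++; map-upTo; map-cong)
open import Data.List.Relation.Binary.BagAndSetEquality using (∼bag⇒↭)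
open import Data.List.Relation.Binary.Permutation.Propositional using (_↭_)
open import Data.List.Relation.Binary.Permutation.Propositional.Properties using (↭-length; filter-↭)
open import Data.List.Relation.Unary.All as All using (All; []; _∷_)
import Data.List.Relation.Unary.All.Properties as Allₚ
open import Data.List.Relation.Unary.AllPairs as AllPairs using (AllPairs; []; _∷_)
import Data.List.Relation.Unary.AllPairs.Properties as AllPairsₚ
open import Data.List.Relation.Unary.Any using (here; there)
open import Data.List.Relation.Unary.Unique.Propositional using (Unique)
import Data.List.Relation.Unary.Unique.Propositional.Properties as Uniqueₚ
open import Data.Nat using (ℕ; zero; suc; _+_; _∸_; _≤_; _<_; z≤n; s≤s; s≤s⁻¹; _≡ᵇ_; _%_; _≟_; _≤?_)
open import Data.Nat.Divisibility using (_∣_; m%n≡0⇒n∣m; n∣m⇒m%n≡0)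
open import Data.Nat.DivMod using ([m+n]%n≡m%n; m%n<n)
open import Data.Nat.Properties hiding (_≟_; _≤?_)
open import Data.Nat.Solver using (module +-*-Solver)
open import Data.Product using (Σ; ∃; ∃₂; _×_; _,_; proj₁; proj₂)
open import Data.Product.Properties using (≡-dec)
open import Data.List.Membership.DecPropositional (≡-dec _≟_ _≟_) using (_∈?_)
open import Data.Sum using (_⊎_; inj₁; inj₂; [_,_]′)
open import Data.Unit using (⊤; tt)
open import Function using (_∘_; id)
open import Function.Bundles using (Equivalence; mk⇔)
open import Relation.Binary.Definitions using (tri<; tri≈; tri>)
open import Relation.Binary.PropositionalEquality
open import Relation.Nullary using (¬_; yes; no)

open Equivalence using (to; from)

-- Existence is not reached by iterating surgeries until none is left, which would call for a
-- termination measure and a rebuilt dissection after every step. `fullyOpen` is one structural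
-- recursion: it opens everything behind a chord, then cuts the cell itself at each chord in a
-- position congruent to 2. The trees that leave a cell number a multiple of 3, so the periodicity
-- of the parent cell and the positions of later siblings survive. Only words are compared on the
-- way, and the forest is turned into a dissection once, at the end. The bulk of the work is the
-- passage between forests and the given definitions. Cells come from filtering all sublists, and
-- the quiddity counts list entries, so the cells must match the nodes without repetition; this
-- rests on a cell being determined by its base side. Indices form a relation, so they are unique
-- only once every side is known to have a single cell above it.

-- The non-base sides of a cell from left to right; `chord H G` starts with a chord behind which
-- lies the cell with non-base sides H, and continues with G.
data Forest : Set where
  ε     : Forest
  edge  : Forest → Forest
  chord : Forest → Forest → Forest

-- Forests laid out along an interval of the polygon.

size : Forest → ℕ
size ε           = 0
size (edge G)    = suc (size G)
size (chord H G) = size H + size G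

len : Forest → ℕ
len ε           = 0
len (edge G)    = suc (len G)
len (chord H G) = suc (len G)

-- Here and below the first argument is the leftmost vertex of the forest.
verts : ℕ → Forest → List ℕ
verts a ε           = a ∷ []
verts a (edge G)    = a ∷ verts (suc a) G
verts a (chord H G) = a ∷ verts (a + size H) G

Node : Set
Node = ℕ × Forest

-- One node per chord, standing for the cell behind it; the forest itself, read as a cell, is added
-- only in `allNodes`.
nodes : ℕ → Forest → List Node
nodes a ε           = []
nodes a (edge G)    = nodes (suc a) G
nodes a (chord H G) = (a , H) ∷ nodes a H ++ nodes (a + size H) G

span : Node → ℕ × ℕ
span (a , H) = a , a + size H

cell : Node → List ℕ
cell (a , H) = verts a H

-- The bound gives each cell behind a chord at least three vertices. It sits at the chords and not
-- on the whole list, so that tails of a list of children are well-formed too; the base cell gets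
-- its bound in `Represents`.
data WF : Forest → Set where
  ε     : WF ε
  edge  : ∀ {G} → WF G → WF (edge G)
  chord : ∀ {H G} → 2 ≤ len H → WF H → WF G → WF (chord H G)

len≤size : ∀ {F} → WF F → len F ≤ size F
len≤size ε = z≤n
len≤size (edge w) = s≤s (len≤size w)
len≤size (chord {H} l w v) = +-mono-≤ (≤-trans (<⇒≤ l) (len≤size w)) (len≤size v)

size≥2 : ∀ {H} → 2 ≤ len H → WF H → 2 ≤ size H
size≥2 l w = ≤-trans l (len≤size w)

at-head : ∀ a F → at (verts a F) 0 ≡ a
at-head a ε           = refl
at-head a (edge F)    = refl
at-head a (chord H F) = refl

length-verts : ∀ a F → length (verts a F) ≡ suc (len F)
length-verts a ε           = refl
length-verts a (edge F)    = cong suc (length-verts (suc a) F)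
length-verts a (chord H F) = cong suc (length-verts (a + size H) F)

at-last : ∀ a F → at (verts a F) (len F) ≡ a + size F
at-last a ε           = sym (+-identityʳ a)
at-last a (edge F)    = trans (at-last (suc a) F) (sym (+-suc a (size F)))
at-last a (chord H F) = trans (at-last (a + size H) F) (+-assoc a (size H) (size F))

baseSide-cell : ∀ ν → baseSide (cell ν) ≡ span ν
baseSide-cell (a , H) rewrite length-verts a H = cong₂ _,_ (at-head a H) (at-last a H)

at≥ : ∀ a {F} → WF F → ∀ s → s ≤ len F → a ≤ at (verts a F) s
at≥ a ε zero z≤n = ≤-refl
at≥ a (edge w) zero _ = ≤-refl
at≥ a (edge w) (suc s) (s≤s l) = ≤-trans (n≤1+n a) (at≥ (suc a) w s l)
at≥ a (chord _ _ w) zero _ = ≤-refl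
at≥ a (chord {H} _ _ w) (suc s) (s≤s l) = ≤-trans (m≤m+n a (size H)) (at≥ (a + size H) w s l)

a<a+size : ∀ a {H} → 2 ≤ len H → WF H → a < a + size H
a<a+size a l w = m<m+n a (<⇒≤ (size≥2 l w))

at-mono : ∀ a {F} → WF F → ∀ {i j} → i < j → j ≤ len F → at (verts a F) i < at (verts a F) j
at-mono a ε {j = zero} () l
at-mono a ε {j = suc j} p ()
at-mono a (edge w) {zero} {suc j} p (s≤s l) = at≥ (suc a) w j l
at-mono a (edge w) {suc i} {suc j} (s≤s p) (s≤s l) = at-mono (suc a) w p l
at-mono a (chord {H} 2≤ v w) {zero} {suc j} p (s≤s l) =
  <-≤-trans (a<a+size a 2≤ v) (at≥ (a + size H) w j l)
at-mono a (chord {H} 2≤ v w) {suc i} {suc j} (s≤s p) (s≤s l) = at-mono (a + size H) w p l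

at-mono≤ : ∀ a {F} → WF F → ∀ {i j} → i ≤ j → j ≤ len F → at (verts a F) i ≤ at (verts a F) j
at-mono≤ a w i≤j l with m≤n⇒m<n∨m≡n i≤j
... | inj₁ i<j  = <⇒≤ (at-mono a w i<j l)
... | inj₂ refl = ≤-refl

at-injective : ∀ a {F} → WF F → ∀ {i j} → i ≤ len F → j ≤ len F →
               at (verts a F) i ≡ at (verts a F) j → i ≡ j
at-injective a w {i} {j} i≤ j≤ eq with <-cmp i j
... | tri< i<j _ _ = ⊥-elim (<⇒≢ (at-mono a w i<j j≤) eq)
... | tri≈ _ e _   = e
... | tri> _ _ j<i = ⊥-elim (<⇒≢ (at-mono a w j<i i≤) (sym eq))

at≤ : ∀ a {F} → WF F → ∀ s → s ≤ len F → at (verts a F) s ≤ a + size F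
at≤ a {F} w s l = subst (at (verts a F) s ≤_) (at-last a F) (at-mono≤ a w l ≤-refl)

nodes-WF : ∀ {a F ν} → WF F → ν ∈ nodes a F → 2 ≤ len (proj₂ ν) × WF (proj₂ ν)
nodes-WF (edge w) m = nodes-WF w m
nodes-WF (chord l v w) (here refl) = l , v
nodes-WF {a} (chord {H} l v w) (there m) with ∈-++⁻ (nodes a H) m
... | inj₁ m′ = nodes-WF v m′
... | inj₂ m′ = nodes-WF w m′

nodes-trans : ∀ {a F ν μ} → ν ∈ nodes a F → μ ∈ nodes (proj₁ ν) (proj₂ ν) → μ ∈ nodes a F
nodes-trans {F = edge G} m k = nodes-trans {F = G} m k
nodes-trans {F = chord H G} (here refl) k = there (∈-++⁺ˡ k)
nodes-trans {a} {F = chord H G} (there m) k with ∈-++⁻ (nodes a H) m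
... | inj₁ m′ = there (∈-++⁺ˡ (nodes-trans {F = H} m′ k))
... | inj₂ m′ = there (∈-++⁺ʳ (nodes a H) (nodes-trans {F = G} m′ k))

start≥ : ∀ {a F ν} → ν ∈ nodes a F → a ≤ proj₁ ν
start≥ {a} {edge G} m = ≤-trans (n≤1+n a) (start≥ {F = G} m)
start≥ {F = chord H G} (here refl) = ≤-refl
start≥ {a} {chord H G} (there m) with ∈-++⁻ (nodes a H) m
... | inj₁ m′ = start≥ {F = H} m′
... | inj₂ m′ = ≤-trans (m≤m+n a (size H)) (start≥ {F = G} m′)

end : Node → ℕ
end ν = proj₂ (span ν)

end≤ : ∀ {a F ν} → ν ∈ nodes a F → end ν ≤ a + size F
end≤ {a} {edge G} {ν} m = subst (end ν ≤_) (sym (+-suc a (size G))) (end≤ {F = G} m)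
end≤ {a} {chord H G} (here refl) = +-monoʳ-≤ a (m≤m+n (size H) (size G))
end≤ {a} {chord H G} {ν} (there m) with ∈-++⁻ (nodes a H) m
... | inj₁ m′ = ≤-trans (end≤ {F = H} m′) (+-monoʳ-≤ a (m≤m+n (size H) (size G)))
... | inj₂ m′ = subst (end ν ≤_) (+-assoc a (size H) (size G)) (end≤ {F = G} m′)

start<end : ∀ {a F ν} → WF F → ν ∈ nodes a F → proj₁ ν < end ν
start<end {ν = b , H} w m = a<a+size b (proj₁ (nodes-WF w m)) (proj₂ (nodes-WF w m))

size-≤ : ∀ {a F ν} → ν ∈ nodes a F → size (proj₂ ν) ≤ size F
size-≤ {F = edge G} m = m≤n⇒m≤1+n (size-≤ {F = G} m)
size-≤ {F = chord H G} (here refl) = m≤m+n (size H) (size G)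
size-≤ {a} {F = chord H G} (there m) with ∈-++⁻ (nodes a H) m
... | inj₁ m′ = ≤-trans (size-≤ {F = H} m′) (m≤m+n (size H) (size G))
... | inj₂ m′ = ≤-trans (size-≤ {F = G} m′) (m≤n+m (size G) (size H))

-- With two children or more, a node always misses the edges behind some other child.
size-strict : ∀ {a F ν} → WF F → 2 ≤ len F → ν ∈ nodes a F → size (proj₂ ν) < size F
size-strict {F = edge G} (edge w) l m = s≤s (size-≤ {F = G} m)
size-strict {F = chord H G} (chord _ v w) (s≤s l) (here refl) = m<m+n (size H) (≤-trans l (len≤size w))
size-strict {a} {F = chord H G} (chord l′ v w) (s≤s l) (there m) with ∈-++⁻ (nodes a H) m
... | inj₁ m′ = ≤-<-trans (size-≤ {F = H} m′) (m<m+n (size H) (≤-trans l (len≤size w)))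
... | inj₂ m′ = ≤-<-trans (size-≤ {F = G} m′) (m<n+m (size G) (<⇒≤ (size≥2 l′ v)))

-- Nesting of nodes.

data Relative (μ ν : Node) : Set where
  same   : μ ≡ ν → Relative μ ν
  inside : μ ∈ nodes (proj₁ ν) (proj₂ ν) → Relative μ ν
  around : ν ∈ nodes (proj₁ μ) (proj₂ μ) → Relative μ ν
  before : end μ ≤ proj₁ ν → Relative μ ν
  after  : end ν ≤ proj₁ μ → Relative μ ν

laminar : ∀ {a F μ ν} → μ ∈ nodes a F → ν ∈ nodes a F → Relative μ ν
laminar {F = edge G} m k = laminar {F = G} m k
laminar {F = chord H G} (here refl) (here refl) = same refl
laminar {a} {F = chord H G} (here refl) (there k) with ∈-++⁻ (nodes a H) k
... | inj₁ k′ = around k′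
... | inj₂ k′ = before (start≥ {F = G} k′)
laminar {a} {F = chord H G} (there m) (here refl) with ∈-++⁻ (nodes a H) m
... | inj₁ m′ = inside m′
... | inj₂ m′ = after (start≥ {F = G} m′)
laminar {a} {F = chord H G} (there m) (there k) with ∈-++⁻ (nodes a H) m | ∈-++⁻ (nodes a H) k
... | inj₁ m′ | inj₁ k′ = laminar {F = H} m′ k′
... | inj₁ m′ | inj₂ k′ = before (≤-trans (end≤ {F = H} m′) (start≥ {F = G} k′))
... | inj₂ m′ | inj₁ k′ = after (≤-trans (end≤ {F = H} k′) (start≥ {F = G} m′))
... | inj₂ m′ | inj₂ k′ = laminar {F = G} m′ k′

nodes-noncrossing : ∀ {a F μ ν} → WF F → μ ∈ nodes a F → ν ∈ nodes a F → ¬ Crosses (span μ) (span ν)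
nodes-noncrossing {F = F} {μ} {ν} w m k (p , q , r) with laminar {F = F} m k
... | same refl = <-irrefl refl p
... | inside i  = <⇒≱ p (start≥ {F = proj₂ ν} i)
... | around i  = <⇒≱ r (end≤ {F = proj₂ μ} i)
... | before b  = <⇒≱ q b
... | after b   = <⇒≱ (<-trans p (start<end w k)) b

-- If ν were inside μ, both would begin at the same vertex, and μ, being strictly longer, would end
-- after ν.
localise : ∀ {a F μ ν} → WF F → μ ∈ nodes a F → ν ∈ nodes a F →
           proj₁ ν ≤ proj₁ μ → end μ ≤ end ν → μ ≡ ν ⊎ μ ∈ nodes (proj₁ ν) (proj₂ ν)
localise {F = F} {b , H} {c , K} w m k p q with laminar {F = F} m k
... | same e   = inj₁ e
... | inside i = inj₂ i
... | around i = ⊥-elim (<⇒≱ sz (+-cancelˡ-≤ b _ _ (subst (λ z → b + size H ≤ z + size K) (sym e) q)))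
  where
  wf = nodes-WF w m
  sz : size K < size H
  sz = size-strict (proj₂ wf) (proj₁ wf) i
  e : b ≡ c
  e = ≤-antisym (start≥ {F = H} i) p
... | before x = ⊥-elim (<⇒≱ (<-≤-trans (start<end w m) x) p)
... | after x  = ⊥-elim (<⇒≱ (start<end w m) (≤-trans q x))

-- Sides of a cell and the uniqueness of the cell above a side.

data Child : ℕ → Forest → ℕ → Node → Set where
  first     : ∀ {a H G} → Child a (chord H G) 0 (a , H)
  pastEdge  : ∀ {a G s ν} → Child (suc a) G s ν → Child a (edge G) (suc s) ν
  pastChord : ∀ {a H G s ν} → Child (a + size H) G s ν → Child a (chord H G) (suc s) ν

Child-side : ∀ {a F s ν} → Child a F s ν → side (verts a F) s ≡ span ν
Child-side {F = chord H G} first = cong (_ ,_) (at-head _ G)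
Child-side (pastEdge c)  = Child-side c
Child-side (pastChord c) = Child-side c

Child-< : ∀ {a F s ν} → Child a F s ν → s < len F
Child-< first         = s≤s z≤n
Child-< (pastEdge c)  = s≤s (Child-< c)
Child-< (pastChord c) = s≤s (Child-< c)

Child-∈ : ∀ {a F s ν} → Child a F s ν → ν ∈ nodes a F
Child-∈ first = here refl
Child-∈ (pastEdge c) = Child-∈ c
Child-∈ {a} {chord H G} (pastChord c) = there (∈-++⁺ʳ (nodes a H) (Child-∈ c))

side-view : ∀ a F s → s < len F →
            (at (verts a F) (suc s) ≡ suc (at (verts a F) s)) ⊎ ∃ (Child a F s)
side-view a (edge F) zero _ = inj₁ (at-head (suc a) F)
side-view a (edge F) (suc s) (s≤s l) with side-view (suc a) F s l
... | inj₁ e       = inj₁ e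
... | inj₂ (ν , c) = inj₂ (ν , pastEdge c)
side-view a (chord H F) zero _ = inj₂ (_ , first)
side-view a (chord H F) (suc s) (s≤s l) with side-view (a + size H) F s l
... | inj₁ e       = inj₁ e
... | inj₂ (ν , c) = inj₂ (ν , pastChord c)

-- A node lies behind one child, hence between two consecutive vertices of the cell.
no-diagonal : ∀ a {F μ i j} → WF F → μ ∈ nodes a F → i < j → j ≤ len F →
              proj₁ μ ≡ at (verts a F) i → end μ ≡ at (verts a F) j → j ≡ suc i
no-diagonal a {edge F} {i = zero} (edge w) m _ _ e _ =
  ⊥-elim (<⇒≢ (start≥ {F = F} m) (sym e))
no-diagonal a {edge F} {i = suc i} {suc j} (edge w) m (s≤s p) (s≤s l) e e′ =
  cong suc (no-diagonal (suc a) w m p l e e′)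
no-diagonal a {chord H F} {i = zero} {suc zero} (chord x v w) m _ _ e e′ = refl
no-diagonal a {chord H F} {μ} {i = zero} {suc (suc j)} (chord x v w) m _ (s≤s l) e e′ = ⊥-elim (inFirst m)
  where
  far : a + size H < end μ
  far = subst₂ _<_ (at-head _ F) (sym e′) (at-mono (a + size H) w {0} (s≤s z≤n) l)
  inFirst : ¬ (μ ∈ nodes a (chord H F))
  inFirst (here refl) = <-irrefl refl far
  inFirst (there m′) with ∈-++⁻ (nodes a H) m′
  ... | inj₁ k = <⇒≱ far (end≤ {F = H} k)
  ... | inj₂ k = <⇒≱ (a<a+size a x v) (subst (a + size H ≤_) e (start≥ {F = F} k))
no-diagonal a {chord H F} {μ} {i = suc i} {suc j} (chord x v w) m (s≤s p) (s≤s l) e e′ = inRest m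
  where
  far : a + size H ≤ proj₁ μ
  far = subst (a + size H ≤_) (sym e) (at≥ (a + size H) w i (≤-trans (<⇒≤ p) l))
  inRest : μ ∈ nodes a (chord H F) → suc j ≡ suc (suc i)
  inRest (here refl) = ⊥-elim (<⇒≱ (a<a+size a x v) far)
  inRest (there m′) with ∈-++⁻ (nodes a H) m′
  ... | inj₁ k = ⊥-elim (<⇒≱ (<-≤-trans (start<end v k) (end≤ {F = H} k)) far)
  ... | inj₂ k = cong suc (no-diagonal (a + size H) w k p l e e′)

-- The node lies behind one side of the cell, so a segment strictly below the node is strictly below
-- that side too. The segment (x , y) may be an edge of the polygon.
side-not-deep : ∀ a {F ν x y s} → WF F → ν ∈ nodes a F → proj₁ ν ≤ x → x < y → y ≤ end ν →
                ¬ (x ≡ proj₁ ν × y ≡ end ν) → s < len F →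
                at (verts a F) s ≡ x → at (verts a F) (suc s) ≡ y → ⊥
side-not-deep a {edge F} {s = zero} (edge w) m p q r ne l refl e′ = <⇒≱ (start≥ {F = F} m) p
side-not-deep a {edge F} {s = suc s} (edge w) m p q r ne (s≤s l) e e′ = side-not-deep (suc a) w m p q r ne l e e′
side-not-deep a {chord H F} {ν} {x} {y} {zero} (chord l′ v w) m p q r ne l refl e′ = inFirst m
  where
  y≡ : y ≡ a + size H
  y≡ = trans (sym e′) (at-head _ F)
  inFirst : ¬ (ν ∈ nodes a (chord H F))
  inFirst (here refl) = ne (refl , y≡)
  inFirst (there m′) with ∈-++⁻ (nodes a H) m′
  ... | inj₁ k = ne (≤-antisym (start≥ {F = H} k) p , ≤-antisym r (subst (end ν ≤_) (sym y≡) (end≤ {F = H} k)))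
  ... | inj₂ k = <⇒≱ (a<a+size a l′ v) (≤-trans (start≥ {F = F} k) p)
side-not-deep a {chord H F} {ν} {x} {y} {suc s} (chord l′ v w) m p q r ne (s≤s l) e e′ = inRest m
  where
  far : a + size H ≤ x
  far = subst (a + size H ≤_) e (at≥ (a + size H) w s (<⇒≤ l))
  inRest : ¬ (ν ∈ nodes a (chord H F))
  inRest (here refl) = <⇒≱ (<-≤-trans q r) far
  inRest (there m′) with ∈-++⁻ (nodes a H) m′
  ... | inj₁ k = <⇒≱ (<-≤-trans q (≤-trans r (end≤ {F = H} k))) far
  ... | inj₂ k = side-not-deep (a + size H) w k p q r ne l e e′

side-proper : ∀ a {F s} → WF F → 2 ≤ len F → s < len F →
              ¬ (at (verts a F) s ≡ a × at (verts a F) (suc s) ≡ a + size F)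
side-proper a {F} {s} w l s< (e , e′)
  with at-injective a w {s} {0} (<⇒≤ s<) z≤n (trans e (sym (at-head a F)))
     | at-injective a w {suc s} {len F} s< ≤-refl (trans e′ (sym (at-last a F)))
... | refl | q = <⇒≢ l q

-- This makes the recursion on indices well defined. For nested cells, a side of the inner one is
-- strictly below the inner base side and so is no side of the outer one; for separated cells, the
-- sides start in disjoint intervals.
parent-unique : ∀ {a F μ ν s t} → WF F → 2 ≤ len F →
  μ ∈ (a , F) ∷ nodes a F → ν ∈ (a , F) ∷ nodes a F → s < len (proj₂ μ) → t < len (proj₂ ν) →
  side (cell μ) s ≡ side (cell ν) t → μ ≡ ν × s ≡ t
parent-unique {a} {F} {μ} {ν} {s} {t} w l m k s< t< e = cases (relative m k)
  where
  wf : ∀ {κ} → κ ∈ (a , F) ∷ nodes a F → 2 ≤ len (proj₂ κ) × WF (proj₂ κ)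
  wf (here refl) = l , w
  wf (there i)   = nodes-WF w i
  relative : ∀ {μ ν} → μ ∈ (a , F) ∷ nodes a F → ν ∈ (a , F) ∷ nodes a F → Relative μ ν
  relative (here refl) (here refl) = same refl
  relative (here refl) (there k)   = around k
  relative (there m)   (here refl) = inside m
  relative (there m)   (there k)   = laminar {F = F} m k
  e₁ = cong proj₁ e
  e₂ = cong proj₂ e
  nested : ∀ {κ λ′ i j} → 2 ≤ len (proj₂ κ) × WF (proj₂ κ) → 2 ≤ len (proj₂ λ′) × WF (proj₂ λ′) →
           i < len (proj₂ κ) → j < len (proj₂ λ′) → side (cell κ) i ≡ side (cell λ′) j →
           κ ∈ nodes (proj₁ λ′) (proj₂ λ′) → ⊥
  nested {b , H} {c , K} {i} (l₁ , w₁) (l₂ , w₂) i< j< e n =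
    side-not-deep c w₂ n (at≥ b w₁ i (<⇒≤ i<)) (at-mono b w₁ ≤-refl i<) (at≤ b w₁ (suc i) i<)
      (side-proper b w₁ l₁ i<) j< (sym (cong proj₁ e)) (sym (cong proj₂ e))
  left : ∀ {κ} i → κ ∈ (a , F) ∷ nodes a F → i < len (proj₂ κ) → proj₁ κ ≤ at (cell κ) i
  left {b , H} i n i< = at≥ b (proj₂ (wf n)) i (<⇒≤ i<)
  right : ∀ {κ} i → κ ∈ (a , F) ∷ nodes a F → i < len (proj₂ κ) → at (cell κ) i < end κ
  right {b , H} i n i< = <-≤-trans (at-mono b (proj₂ (wf n)) ≤-refl i<) (at≤ b (proj₂ (wf n)) (suc i) i<)
  cases : Relative μ ν → μ ≡ ν × s ≡ t
  cases (same refl) = refl , at-injective (proj₁ μ) (proj₂ (wf m)) (<⇒≤ s<) (<⇒≤ t<) e₁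
  cases (inside n)  = ⊥-elim (nested (wf m) (wf k) s< t< e n)
  cases (around n)  = ⊥-elim (nested (wf k) (wf m) t< s< (sym e) n)
  cases (before b)  = ⊥-elim (<⇒≱ (right s m s<) (≤-trans b (subst (proj₁ ν ≤_) (sym e₁) (left t k t<))))
  cases (after b)   = ⊥-elim (<⇒≱ (right t k t<) (≤-trans b (subst (proj₁ μ ≤_) e₁ (left s m s<))))

-- Boundary words and positions modulo 3.

-- `false` is an edge of the polygon, `true` an end of a chord, left or right.
word : Forest → List Bool
word ε           = []
word (edge G)    = false ∷ word G
word (chord H G) = true ∷ word H ++ true ∷ word G

-- A type of its own, so that `Good` and `split` can match on positions; `toℕ₃-residue` links it to
-- `%`.
data ℤ₃ : Set where
  0₃ 1₃ 2₃ : ℤ₃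

next : ℤ₃ → ℤ₃
next 0₃ = 1₃
next 1₃ = 2₃
next 2₃ = 0₃

residue : ℕ → ℤ₃
residue zero    = 0₃
residue (suc n) = next (residue n)

next³ : ∀ p → next (next (next p)) ≡ p
next³ 0₃ = refl
next³ 1₃ = refl
next³ 2₃ = refl

toℕ₃ : ℤ₃ → ℕ
toℕ₃ 0₃ = 0
toℕ₃ 1₃ = 1
toℕ₃ 2₃ = 2

toℕ₃-residue : ∀ n → toℕ₃ (residue n) ≡ n % 3
toℕ₃-residue 0 = refl
toℕ₃-residue 1 = refl
toℕ₃-residue 2 = refl
toℕ₃-residue (suc (suc (suc n))) =
  trans (cong toℕ₃ (next³ (residue n)))
  (trans (toℕ₃-residue n) (trans (sym ([m+n]%n≡m%n n 3)) (cong (_% 3) (+-comm n 3))))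

-- Maximally open forests and their unique parsing.

-- A non-base cell with children F, read from its p-th child on, that admits no opening surgery.
data Good : ℤ₃ → Forest → Set where
  ε     : Good 2₃ ε
  edge  : ∀ {p G} → Good (next p) G → Good p (edge G)
  chord : ∀ {p H G} → p ≢ 2₃ → Good 0₃ H → Good (next p) G → Good p (chord H G)

-- The children of the base cell: its base side is an edge, so no surgery applies there and chords
-- may stand at any position.
data AllGood : Forest → Set where
  ε     : AllGood ε
  edge  : ∀ {G} → AllGood G → AllGood (edge G)
  chord : ∀ {H G} → Good 0₃ H → AllGood G → AllGood (chord H G)

-- Inside a cell the next chord end is a right end exactly at the positions ≡ 2 mod 3.
Good-parse : ∀ {p F F′ u u′} → Good p F → Good p F′ →
             word F ++ true ∷ u ≡ word F′ ++ true ∷ u′ → F ≡ F′ × u ≡ u′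
Good-parse ε ε e = refl , ∷-injectiveʳ e
Good-parse ε (chord p _ _) e = ⊥-elim (p refl)
Good-parse (edge g) (edge g′) e with Good-parse g g′ (∷-injectiveʳ e)
... | refl , e′ = refl , e′
Good-parse (chord p _ _) ε e = ⊥-elim (p refl)
Good-parse {F = chord H G} {chord H′ G′} {u} {u′} (chord _ h g) (chord _ h′ g′) e
  with Good-parse h h′ (trans (sym (++-assoc (word H) (true ∷ word G) (true ∷ u)))
         (trans (∷-injectiveʳ e) (++-assoc (word H′) (true ∷ word G′) (true ∷ u′))))
... | refl , e′ with Good-parse g g′ e′
... | refl , e″ = refl , e″

-- At the top level no chord is open, so each chord end met there is a left end, whatever its
-- position.
word-injective : ∀ {F F′} → AllGood F → AllGood F′ → word F ≡ word F′ → F ≡ F′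
word-injective ε ε e = refl
word-injective (edge g) (edge g′) e = cong edge (word-injective g g′ (∷-injectiveʳ e))
word-injective (chord h g) (chord h′ g′) e with Good-parse h h′ (∷-injectiveʳ e)
... | refl , e′ = cong (chord _) (word-injective g g′ e′)

-- Opening all cells of a periodic forest.

advance : ℤ₃ → Forest → ℤ₃
advance p ε           = p
advance p (edge G)    = advance (next p) G
advance p (chord H G) = advance (next p) G

advance-residue : ∀ k F → advance (residue k) F ≡ residue (k + len F)
advance-residue k ε = cong residue (sym (+-identityʳ k))
advance-residue k (edge F) = trans (advance-residue (suc k) F) (cong residue (sym (+-suc k (len F))))
advance-residue k (chord H F) = trans (advance-residue (suc k) F) (cong residue (sym (+-suc k (len F))))

advance-next : ∀ p F → advance (next p) F ≡ next (advance p F)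
advance-next p ε           = refl
advance-next p (edge F)    = advance-next (next p) F
advance-next p (chord H F) = advance-next (next p) F

Good-advance : ∀ {p F} → Good p F → advance p F ≡ 2₃
Good-advance ε             = refl
Good-advance (edge g)      = Good-advance g
Good-advance (chord _ _ g) = Good-advance g

Good⇒AllGood : ∀ {p F} → Good p F → AllGood F
Good⇒AllGood ε             = ε
Good⇒AllGood (edge g)      = edge (Good⇒AllGood g)
Good⇒AllGood (chord _ h g) = chord h (Good⇒AllGood g)

-- `advance 0₃ H ≡ 2₃` means 2 modulo 3 non-base sides, that is, a number of vertices divisible by
-- 3.
data Periodic : Forest → Set where
  ε     : Periodic ε
  edge  : ∀ {G} → Periodic G → Periodic (edge G)
  chord : ∀ {H G} → advance 0₃ H ≡ 2₃ → Periodic H → Periodic G → Periodic (chord H G)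

infixr 5 _⊕_

_⊕_ : Forest → Forest → Forest
ε         ⊕ G = G
edge F    ⊕ G = edge (F ⊕ G)
chord H F ⊕ G = chord H (F ⊕ G)

advance-⊕ : ∀ p F G → advance p (F ⊕ G) ≡ advance (advance p F) G
advance-⊕ p ε G           = refl
advance-⊕ p (edge F) G    = advance-⊕ (next p) F G
advance-⊕ p (chord H F) G = advance-⊕ (next p) F G

AllGood-⊕ : ∀ {F G} → AllGood F → AllGood G → AllGood (F ⊕ G)
AllGood-⊕ ε g           = g
AllGood-⊕ (edge f) g    = edge (AllGood-⊕ f g)
AllGood-⊕ (chord h f) g = chord h (AllGood-⊕ f g)

word-⊕ : ∀ F G → word (F ⊕ G) ≡ word F ++ word G
word-⊕ ε G           = refl
word-⊕ (edge F) G    = cong (false ∷_) (word-⊕ F G)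
word-⊕ (chord H F) G = cong (true ∷_)
  (trans (cong (λ w → word H ++ true ∷ w) (word-⊕ F G)) (sym (++-assoc (word H) (true ∷ word F) (word G))))

-- `split p L` performs all opening surgeries on a cell whose children from position p on are L:
-- the first component lists the children it keeps, the second the trees that then follow it
-- in the parent cell.
split : ℤ₃ → Forest → Forest × Forest
split p  ε           = ε , ε
split p  (edge G)    = let A , R = split (next p) G in edge A , R
-- The left end of this chord now closes the cell, H moves up to the parent, and the former right
-- end opens a new cell on what remains, read from position 0.
split 2₃ (chord H G) = let A , R = split 0₃ G in ε , H ⊕ chord A R
split 0₃ (chord H G) = let A , R = split 1₃ G in chord H A , R
split 1₃ (chord H G) = let A , R = split 2₃ G in chord H A , R

-- Each cut releases the children of H, 2 modulo 3 in number, together with one new chord. Hence R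
-- has a multiple of 3 trees, which is the content of `advance 2₃ R ≡ 2₃`.
split-good : ∀ p {L} → AllGood L → advance p L ≡ 2₃ →
             let A , R = split p L in Good p A × AllGood R × advance 2₃ R ≡ 2₃
split-good p ε refl = ε , ε , refl
split-good p (edge g) e = let a , r , f = split-good (next p) g e in edge a , r , f
split-good 0₃ (chord h g) e = let a , r , f = split-good 1₃ g e in chord (λ ()) h a , r , f
split-good 1₃ (chord h g) e = let a , r , f = split-good 2₃ g e in chord (λ ()) h a , r , f
split-good 2₃ {chord H G} (chord h g) e =
  let a , r , f = split-good 0₃ g e
      A , R = split 0₃ G
      H-advance : advance 2₃ H ≡ 1₃
      H-advance = trans (advance-next 1₃ H) (cong next (trans (advance-next 0₃ H) (cong next (Good-advance h))))
  in ε , AllGood-⊕ (Good⇒AllGood h) (chord a r)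
   , trans (advance-⊕ 2₃ H (chord A R)) (trans (cong (λ q → advance q (chord A R)) H-advance) f)

-- The last `true` on the right is the right end of the chord above the cell. On the left that chord
-- is closed by the letter after A; cuts pair the ends anew and leave the order of letters alone.
split-word : ∀ p L → let A , R = split p L in word A ++ true ∷ word R ≡ word L ++ true ∷ []
split-word p ε = refl
split-word p (edge L) = cong (false ∷_) (split-word (next p) L)
split-word 2₃ (chord H G) = let A , R = split 0₃ G in cong (true ∷_)
  (trans (word-⊕ H (chord A R))
  (trans (cong (λ w → word H ++ true ∷ w) (split-word 0₃ G))
         (sym (++-assoc (word H) (true ∷ word G) (true ∷ [])))))
split-word 0₃ (chord H G) = let A , R = split 1₃ G in cong (true ∷_)
  (trans (++-assoc (word H) (true ∷ word A) (true ∷ word R))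
  (trans (cong (λ w → word H ++ true ∷ w) (split-word 1₃ G))
         (sym (++-assoc (word H) (true ∷ word G) (true ∷ [])))))
split-word 1₃ (chord H G) = let A , R = split 2₃ G in cong (true ∷_)
  (trans (++-assoc (word H) (true ∷ word A) (true ∷ word R))
  (trans (cong (λ w → word H ++ true ∷ w) (split-word 2₃ G))
         (sym (++-assoc (word H) (true ∷ word G) (true ∷ [])))))

fullyOpen : Forest → Forest
fullyOpen ε           = ε
fullyOpen (edge G)    = edge (fullyOpen G)
fullyOpen (chord H G) = let A , R = split 0₃ (fullyOpen H) in chord A R ⊕ fullyOpen G

-- The second component carries the induction: the parent stays periodic because opening its
-- children keeps their number modulo 3.
fullyOpen-good : ∀ {F} → Periodic F →
                 AllGood (fullyOpen F) × (∀ p → advance p (fullyOpen F) ≡ advance p F)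
fullyOpen-good ε = ε , λ p → refl
fullyOpen-good (edge w) = let g , a = fullyOpen-good w in edge g , λ p → a (next p)
fullyOpen-good {chord H G} (chord e v w) =
  let h , b = fullyOpen-good v
      g , a = fullyOpen-good w
      A , R = split 0₃ (fullyOpen H)
      A-good , R-good , R-advance = split-good 0₃ h (trans (b 0₃) e)
      R-neutral : ∀ p → advance p R ≡ p
      R-neutral = λ { 0₃ → trans (advance-next 2₃ R) (cong next R-advance)
                    ; 1₃ → trans (advance-next 0₃ R) (cong next (trans (advance-next 2₃ R) (cong next R-advance)))
                    ; 2₃ → R-advance }
  in AllGood-⊕ (chord A-good R-good) g
   , λ p → trans (advance-⊕ (next p) R (fullyOpen G))
       (trans (cong (λ q → advance q (fullyOpen G)) (R-neutral (next p))) (a (next p)))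

fullyOpen-word : ∀ F → word (fullyOpen F) ≡ word F
fullyOpen-word ε = refl
fullyOpen-word (edge F) = cong (false ∷_) (fullyOpen-word F)
fullyOpen-word (chord H G) = let A , R = split 0₃ (fullyOpen H) in cong (true ∷_) (begin
    word A ++ true ∷ word (R ⊕ fullyOpen G)
  ≡⟨ cong (λ w → word A ++ true ∷ w) (word-⊕ R (fullyOpen G)) ⟩
    word A ++ true ∷ word R ++ word (fullyOpen G)
  ≡⟨ ++-assoc (word A) (true ∷ word R) (word (fullyOpen G)) ⟨
    (word A ++ true ∷ word R) ++ word (fullyOpen G)
  ≡⟨ cong₂ _++_ (split-word 0₃ (fullyOpen H)) (fullyOpen-word G) ⟩
    (word (fullyOpen H) ++ true ∷ []) ++ word G
  ≡⟨ ++-assoc (word (fullyOpen H)) (true ∷ []) (word G) ⟩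
    word (fullyOpen H) ++ true ∷ word G
  ≡⟨ cong (_++ true ∷ word G) (fullyOpen-word H) ⟩
    word H ++ true ∷ word G
  ∎)
  where open ≡-Reasoning

-- Recovering a word from its chord ends at each vertex.

edges : List Bool → ℕ
edges []          = 0
edges (true  ∷ w) = edges w
edges (false ∷ w) = suc (edges w)

edges-++ : ∀ u v → edges (u ++ v) ≡ edges u + edges v
edges-++ [] v          = refl
edges-++ (true  ∷ u) v = edges-++ u v
edges-++ (false ∷ u) v = cong suc (edges-++ u v)

edges-word : ∀ F → edges (word F) ≡ size F
edges-word ε           = refl
edges-word (edge F)    = cong suc (edges-word F)
edges-word (chord H F) = trans (edges-++ (word H) (true ∷ word F)) (cong₂ _+_ (edges-word H) (edges-word F))

δ : ℕ → ℕ → ℕ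
δ zero    zero    = 1
δ zero    (suc i) = 0
δ (suc a) zero    = 0
δ (suc a) (suc i) = δ a i

δ-refl : ∀ a → δ a a ≡ 1
δ-refl zero    = refl
δ-refl (suc a) = δ-refl a

-- Chord ends at vertex i, when the word is read from vertex a on.
degree : List Bool → ℕ → ℕ → ℕ
degree []          a i = 0
degree (true  ∷ w) a i = δ a i + degree w a i
degree (false ∷ w) a i = degree w (suc a) i

degree-++ : ∀ u v a i → degree (u ++ v) a i ≡ degree u a i + degree v (a + edges u) i
degree-++ [] v a i = cong (λ z → degree v z i) (sym (+-identityʳ a))
degree-++ (true ∷ u) v a i = trans (cong (δ a i +_) (degree-++ u v a i)) (sym (+-assoc (δ a i) _ _))
degree-++ (false ∷ u) v a i = trans (degree-++ u v (suc a) i)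
  (cong (λ z → degree u (suc a) i + degree v z i) (sym (+-suc a (edges u))))

δ-< : ∀ {a i} → i < a → δ a i ≡ 0
δ-< {suc a} {zero}  p       = refl
δ-< {suc a} {suc i} (s≤s p) = δ-< p

degree-< : ∀ w {a i} → i < a → degree w a i ≡ 0
degree-< [] p = refl
degree-< (true  ∷ w) p = cong₂ _+_ (δ-< p) (degree-< w p)
degree-< (false ∷ w) p = degree-< w (m<n⇒m<1+n p)

-- Letters after a `false` count only at later vertices. So a word starting at a begins with `true`
-- iff its degree at a is positive, and the first letters agree.
degree-injective : ∀ u v a → edges u ≡ edges v →
  (∀ i → a ≤ i → i ≤ a + edges u → degree u a i ≡ degree v a i) → u ≡ v
degree-injective [] [] a e h = refl
degree-injective [] (true ∷ v) a e h with trans (h a ≤-refl (m≤m+n a 0)) (cong (_+ degree v a a) (δ-refl a))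
... | ()
degree-injective (true ∷ u) [] a e h with trans (cong (_+ degree u a a) (sym (δ-refl a))) (h a ≤-refl (m≤m+n a _))
... | ()
degree-injective (true ∷ u) (true ∷ v) a e h =
  cong (true ∷_) (degree-injective u v a e λ i p q → +-cancelˡ-≡ (δ a i) _ _ (h i p q))
degree-injective (true ∷ u) (false ∷ v) a e h
  with trans (cong (_+ degree u a a) (sym (δ-refl a))) (trans (h a ≤-refl (m≤m+n a _)) (degree-< v ≤-refl))
... | ()
degree-injective (false ∷ u) (true ∷ v) a e h
  with trans (trans (sym (degree-< u ≤-refl)) (h a ≤-refl (m≤m+n a _))) (cong (_+ degree v a a) (δ-refl a))
... | ()
degree-injective (false ∷ u) (false ∷ v) a e h =
  cong (false ∷_) (degree-injective u v (suc a) (suc-injective e)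
    λ i p q → h i (<⇒≤ p) (subst (i ≤_) (sym (+-suc a (edges u))) q))


-- The Boolean enumeration of cells.

membᵇ-sound : ∀ {p} cs → T (membᵇ p cs) → p ∈ cs
membᵇ-sound {a , b} ((c , d) ∷ cs) t with to T-∨ t
... | inj₁ u = let v , w = to T-∧ u in here (cong₂ _,_ (≡ᵇ⇒≡ a c v) (≡ᵇ⇒≡ b d w))
... | inj₂ u = there (membᵇ-sound cs u)

membᵇ-complete : ∀ {p cs} → p ∈ cs → T (membᵇ p cs)
membᵇ-complete {a , b} (here refl) = from T-∨ (inj₁ (from T-∧ (≡⇒≡ᵇ a a refl , ≡⇒≡ᵇ b b refl)))
membᵇ-complete {a , b} {(c , d) ∷ _} (there m) = from (T-∨ {(a ≡ᵇ c) ∧ (b ≡ᵇ d)}) (inj₂ (membᵇ-complete m))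

record IsCell {n} (D : Dissection n) (vs : List ℕ) : Set where
  field
    long   : 2 < length vs
    sides  : ∀ s → suc s < length vs → at vs (suc s) ≡ suc (at vs s) ⊎ side vs s ∈ chords D
    bottom : baseSide vs ≡ (0 , suc n) ⊎ baseSide vs ∈ chords D
    noDiag : ∀ i j → suc i < j → j < length vs → ¬ (i ≡ 0 × j ≡ length vs ∸ 1) →
             ¬ ((at vs i , at vs j) ∈ chords D)

implication-elim : ∀ {x y} → T (not x ∨ y) → T x → T y
implication-elim {true} t _ = t

implication-intro : ∀ {x y} → (T x → T y) → T (not x ∨ y)
implication-intro {true}  f = f _
implication-intro {false} f = _

T-not-elim : ∀ {x} → T (not x) → ¬ T x
T-not-elim {true} ()
T-not-elim {false} _ ()

T-not-intro : ∀ {x} → ¬ T x → T (not x)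
T-not-intro {true} f  = ⊥-elim (f _)
T-not-intro {false} _ = _

module _ {n} (D : Dissection n) where

  isCellᵇ-sound : ∀ vs → T (isCellᵇ D vs) → IsCell D vs
  isCellᵇ-sound vs t = record
    { long   = <ᵇ⇒< 2 k (proj₁ t₁)
    ; sides  = λ s l → [ inj₁ ∘ ≡ᵇ⇒≡ _ _ , inj₂ ∘ membᵇ-sound (chords D) ]′
                 (to T-∨ (implication-elim (Allₚ.applyUpTo⁻ id k (Allₚ.all⁺ _ (upTo k) (proj₁ t₂)) (<⇒≤ l)) (<⇒<ᵇ l)))
    ; bottom = [ (λ u → let v , w = to T-∧ u in inj₁ (cong₂ _,_ (≡ᵇ⇒≡ _ _ v) (≡ᵇ⇒≡ _ _ w)))
               , inj₂ ∘ membᵇ-sound (chords D) ]′ (to T-∨ (proj₁ t₃))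
    ; noDiag = λ i j p q ne m → T-not-elim
                 (implication-elim
                   (Allₚ.applyUpTo⁻ id k (Allₚ.all⁺ _ (upTo k)
                     (Allₚ.applyUpTo⁻ id k (Allₚ.all⁺ _ (upTo k) (proj₂ t₃)) (<-trans (<-trans (n<1+n i) p) q))) q)
                   (from T-∧ (<⇒<ᵇ p , from T-∧ (<⇒<ᵇ q ,
                     T-not-intro (λ u → let v , w = to T-∧ u in ne (≡ᵇ⇒≡ _ _ v , ≡ᵇ⇒≡ _ _ w))))))
                 (membᵇ-complete m)
    }
    where
    k = length vs
    t₁ = to T-∧ t
    t₂ = to T-∧ (proj₂ t₁)
    t₃ = to T-∧ (proj₂ t₂)

  isCellᵇ-complete : ∀ vs → IsCell D vs → T (isCellᵇ D vs)
  isCellᵇ-complete vs c = from T-∧ (<⇒<ᵇ long , from T-∧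
    ( Allₚ.all⁻ _ (Allₚ.applyUpTo⁺₁ id k λ {s} _ → implication-intro λ l →
        from T-∨ ([ inj₁ ∘ ≡⇒≡ᵇ _ _ , inj₂ ∘ membᵇ-complete ]′ (sides s (<ᵇ⇒< _ _ l))))
    , from T-∧
    ( from T-∨ ([ (λ e → inj₁ (from T-∧ (≡⇒≡ᵇ _ _ (cong proj₁ e) , ≡⇒≡ᵇ _ _ (cong proj₂ e))))
                , inj₂ ∘ membᵇ-complete ]′ bottom)
    , Allₚ.all⁻ _ (Allₚ.applyUpTo⁺₁ id k λ {i} _ → Allₚ.all⁻ _ (Allₚ.applyUpTo⁺₁ id k λ {j} _ → implication-intro λ u →
        let p , v = to T-∧ u
            q , w = to T-∧ v
        in T-not-intro λ m → noDiag i j (<ᵇ⇒< _ _ p) (<ᵇ⇒< _ _ q)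
             (λ { (refl , e) → T-not-elim w (from T-∧ (_ , ≡⇒≡ᵇ j (k ∸ 1) e)) })
             (membᵇ-sound (chords D) m))))))
    where
    open IsCell c
    k = length vs

filterᵇ≡filter : ∀ {A : Set} (p : A → Bool) xs → filterᵇ p xs ≡ filter (T? ∘ p) xs
filterᵇ≡filter p [] = refl
filterᵇ≡filter p (x ∷ xs) with p x
... | true  = cong (x ∷_) (filterᵇ≡filter p xs)
... | false = filterᵇ≡filter p xs

Increasing : List ℕ → Set
Increasing = AllPairs _<_

sublists-All : ∀ {A : Set} {P : A → Set} {xs ys} → All P xs → ys ∈ sublists xs → All P ys
sublists-All [] (here refl) = []
sublists-All {xs = x ∷ xs} (p ∷ ps) m with ∈-++⁻ (map (x ∷_) (sublists xs)) m
... | inj₂ k = sublists-All ps k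
... | inj₁ k with ∈-map⁻ (x ∷_) k
... | ys , k′ , refl = p ∷ sublists-All ps k′

sublists-AllPairs : ∀ {A : Set} {R : A → A → Set} {xs ys} → AllPairs R xs → ys ∈ sublists xs → AllPairs R ys
sublists-AllPairs [] (here refl) = []
sublists-AllPairs {xs = x ∷ xs} (p ∷ ps) m with ∈-++⁻ (map (x ∷_) (sublists xs)) m
... | inj₂ k = sublists-AllPairs ps k
... | inj₁ k with ∈-map⁻ (x ∷_) k
... | ys , k′ , refl = sublists-All p k′ ∷ sublists-AllPairs ps k′

[]∈sublists : ∀ {A : Set} (xs : List A) → [] ∈ sublists xs
[]∈sublists [] = here refl
[]∈sublists (x ∷ xs) = ∈-++⁺ʳ (map (x ∷_) (sublists xs)) ([]∈sublists xs)

-- A general f is used because `upTo` unfolds to `applyUpTo` of a composite with `suc`.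
increasing⇒sublist : ∀ m a (f : ℕ → ℕ) → (∀ i → f i ≡ a + i) → ∀ {ys} → Increasing ys →
                     All (a ≤_) ys → All (_< a + m) ys → ys ∈ sublists (applyUpTo f m)
increasing⇒sublist m a f e [] _ _ = []∈sublists (applyUpTo f m)
increasing⇒sublist zero a f e (_ ∷ _) (p ∷ _) (q ∷ _) = ⊥-elim (<⇒≱ (subst (_ <_) (+-identityʳ a) q) p)
increasing⇒sublist (suc m) a f e {y ∷ ys} (i ∷ is) (p ∷ ps) (q ∷ qs) with m≤n⇒m<n∨m≡n p
... | inj₁ a<y = ∈-++⁺ʳ (map (f 0 ∷_) (sublists (applyUpTo (f ∘ suc) m)))
        (increasing⇒sublist m (suc a) (f ∘ suc) (λ i → trans (e (suc i)) (+-suc a i)) (i ∷ is)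
          (a<y ∷ All.map (<-trans a<y) i)
          (All.map (λ {z} → subst (z <_) (+-suc a m)) (q ∷ qs)))
... | inj₂ refl = ∈-++⁺ˡ (subst (λ z → a ∷ ys ∈ map (z ∷_) (sublists (applyUpTo (f ∘ suc) m)))
        (sym (trans (e 0) (+-identityʳ a)))
        (∈-map⁺ (a ∷_) (increasing⇒sublist m (suc a) (f ∘ suc) (λ i → trans (e (suc i)) (+-suc a i)) is
          i (All.map (λ {z} → subst (z <_) (+-suc a m)) qs))))

cells≡filter : ∀ {n} (D : Dissection n) → cells D ≡ filter (T? ∘ isCellᵇ D) (sublists (upTo (suc (suc n))))
cells≡filter {n} D = filterᵇ≡filter (isCellᵇ D) (sublists (upTo (suc (suc n))))

∈-cells⁻ : ∀ {n} (D : Dissection n) {vs} → vs ∈ cells D → Increasing vs × IsCell D vs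
∈-cells⁻ {n} D {vs} m with ∈-filter⁻ (T? ∘ isCellᵇ D) (subst (vs ∈_) (cells≡filter D) m)
... | k , t = sublists-AllPairs (AllPairsₚ.applyUpTo⁺₁ id (suc (suc n)) (λ p _ → p)) k , isCellᵇ-sound D vs t

∈-cells⁺ : ∀ {n} (D : Dissection n) {vs} → Increasing vs → All (_< suc (suc n)) vs → IsCell D vs → vs ∈ cells D
∈-cells⁺ {n} D {vs} i b c = subst (vs ∈_) (sym (cells≡filter D))
  (∈-filter⁺ (T? ∘ isCellᵇ D)
    (increasing⇒sublist (suc (suc n)) 0 id (λ _ → refl) i (All.map (λ _ → z≤n) b) b)
    (isCellᵇ-complete D vs c))

-- A cell is determined by its base side.

module _ (b : ℕ) (C : ℕ → ℕ → Set) where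

  -- The non-base sides of a cell, read as a path to the right end b of its base side; the third
  -- argument of `step` forbids diagonals from x.
  data Path : ℕ → List ℕ → Set where
    done : Path b []
    step : ∀ {x y us} → x < y → y ≡ suc x ⊎ C x y → (∀ {z} → z ∈ us → ¬ C x z) → Path y us → Path x (y ∷ us)

  Path-≤ : ∀ {x us} → Path x us → x ≤ b
  Path-≤ done           = ≤-refl
  Path-≤ (step l _ _ p) = ≤-trans (<⇒≤ l) (Path-≤ p)

  -- A vertex skipped by the path lies strictly below one of its steps, and that step is a chord
  -- since nothing lies strictly below an edge.
  Path-hits : ∀ {x us z} → Path x us → x ≤ z → z ≤ b →
              z ∈ x ∷ us ⊎ ∃₂ λ u v → x ≤ u × u < z × z < v × C u v
  Path-hits done p q = inj₁ (here (≤-antisym q p))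
  Path-hits {x} {y ∷ us} {z} (step l s _ π) p q with <-cmp z y
  ... | tri≈ _ e _ = inj₁ (there (here e))
  ... | tri> _ _ y<z with Path-hits π (<⇒≤ y<z) q
  ...   | inj₁ m = inj₁ (there m)
  ...   | inj₂ (u , v , r , t) = inj₂ (u , v , ≤-trans (<⇒≤ l) r , t)
  Path-hits {x} {y ∷ us} {z} (step l s _ π) p q | tri< z<y _ _ with m≤n⇒m<n∨m≡n p
  ... | inj₂ e   = inj₁ (here (sym e))
  ... | inj₁ x<z with s
  ...   | inj₁ refl = ⊥-elim (<⇒≱ x<z (s≤s⁻¹ z<y))
  ...   | inj₂ c    = inj₂ (x , y , ≤-refl , x<z , z<y , c)

  module _ (noncrossing : ∀ {p q u v} → C p q → C u v → ¬ (p < u × u < q × q < v)) where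

    -- The longer of two different first steps would be a diagonal of, or cross, the other path.
    Path-not-shorter : ∀ {x y us z} → Path x (y ∷ us) → y < z → z ≤ b → ¬ (z ≡ suc x ⊎ C x z)
    Path-not-shorter (step l _ _ π) y<z z≤b (inj₁ refl) = <⇒≱ l (s≤s⁻¹ y<z)
    Path-not-shorter (step l _ d π) y<z z≤b (inj₂ c) with Path-hits π (<⇒≤ y<z) z≤b
    ... | inj₁ (here refl) = <-irrefl refl y<z
    ... | inj₁ (there m)   = d m c
    ... | inj₂ (u , v , r , t , w , c′) = noncrossing c c′ (<-≤-trans l r , t , w)

    Path-unique : ∀ {x us us′} → Path x us → Path x us′ → us ≡ us′
    Path-unique done done = refl
    Path-unique done (step l _ _ p) = ⊥-elim (<⇒≱ l (Path-≤ p))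
    Path-unique (step l _ _ p) done = ⊥-elim (<⇒≱ l (Path-≤ p))
    Path-unique π@(step {y = y} l s d p) π′@(step {y = y′} l′ s′ d′ p′) with <-cmp y y′
    ... | tri< y<y′ _ _ = ⊥-elim (Path-not-shorter π y<y′ (Path-≤ p′) s′)
    ... | tri> _ _ y′<y = ⊥-elim (Path-not-shorter π′ y′<y (Path-≤ p) s)
    ... | tri≈ _ refl _ = cong (y ∷_) (Path-unique p p′)

  ∈⇒at : ∀ {z us} → z ∈ us → ∃ λ j → j < length us × at us j ≡ z
  ∈⇒at (here refl) = 0 , s≤s z≤n , refl
  ∈⇒at (there m) with ∈⇒at m
  ... | j , l , e = suc j , s≤s l , e

  toPath : ∀ x us → Increasing (x ∷ us) → at (x ∷ us) (length us) ≡ b →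
    (∀ s → suc s < length (x ∷ us) → at (x ∷ us) (suc s) ≡ suc (at (x ∷ us) s) ⊎ C (at (x ∷ us) s) (at (x ∷ us) (suc s))) →
    (∀ i j → suc i < j → j < length (x ∷ us) → ¬ C (at (x ∷ us) i) (at (x ∷ us) j)) →
    Path x us
  toPath x [] _ refl _ _ = done
  toPath x (y ∷ us) ((l ∷ _) ∷ is) e s d = step l (s 0 (s≤s (s≤s z≤n)))
    (λ m c → let j , p , q = ∈⇒at m in d 0 (suc (suc j)) (s≤s (s≤s z≤n)) (s≤s (s≤s p)) (subst (C x) (sym q) c))
    (toPath y us is e (λ t p → s (suc t) (s≤s p)) (λ i j p q → d (suc i) (suc j) (s≤s p) (s≤s q)))

All-at : ∀ {P : ℕ → Set} {vs} → All P vs → ∀ {i} → i < length vs → P (at vs i)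
All-at (p ∷ ps) {zero}  _       = p
All-at (p ∷ ps) {suc i} (s≤s l) = All-at ps l

Increasing-at : ∀ {vs} → Increasing vs → ∀ {i j} → i < j → j < length vs → at vs i < at vs j
Increasing-at (p ∷ ps) {zero}  {suc j} _       (s≤s l) = All-at p l
Increasing-at (p ∷ ps) {suc i} {suc j} (s≤s q) (s≤s l) = Increasing-at ps q l

module _ {n} (D : Dissection n) where

  -- The base side p is excluded: it may be a chord, and it joins the two ends of the path.
  Diagonal : ℕ × ℕ → ℕ → ℕ → Set
  Diagonal p x y = (x , y) ∈ chords D × (x , y) ≢ p

  cell⇒Path : ∀ {vs p} → Increasing vs → IsCell D vs → baseSide vs ≡ p →
              ∃ λ us → vs ≡ proj₁ p ∷ us × Path (proj₂ p) (Diagonal p) (proj₁ p) us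
  cell⇒Path {[]} i c e with () ← IsCell.long c
  cell⇒Path {vs@(x ∷ us)} i c refl = us , refl , toPath _ _ x us i refl
    (λ s l → [ inj₁ , (λ m → inj₂ (m , notBase s l)) ]′ (sides s l))
    (λ { i j p q (m , ne) → noDiag i j p q (λ { (refl , refl) → ne refl }) m })
    where
    open IsCell c
    notBase : ∀ s → suc s < length vs → side vs s ≢ baseSide vs
    notBase zero l e = <⇒≢ (Increasing-at i {1} {length vs ∸ 1} (s≤s⁻¹ long) ≤-refl) (cong proj₂ e)
    notBase (suc s) l e = <⇒≢ (Increasing-at i {0} {suc s} (s≤s z≤n) (<⇒≤ l)) (sym (cong proj₁ e))

  cell-unique : ∀ {vs us} → Increasing vs → IsCell D vs → Increasing us → IsCell D us →
                baseSide vs ≡ baseSide us → vs ≡ us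
  cell-unique iv cv iu cu e with cell⇒Path iv cv e | cell⇒Path iu cu refl
  ... | _ , e₁ , π | _ , e₂ , ρ =
    trans e₁ (trans (cong (_ ∷_) (Path-unique _ _ (λ { (m , _) (k , _) → noncross D m k }) π ρ)) (sym e₂))

-- Forests that represent a dissection, and their cells.

verts-lower : ∀ a F → WF F → All (a ≤_) (verts a F)
verts-lower a ε w = ≤-refl ∷ []
verts-lower a (edge F) (edge w) = ≤-refl ∷ All.map <⇒≤ (verts-lower (suc a) F w)
verts-lower a (chord H F) (chord _ _ w) = ≤-refl ∷ All.map (≤-trans (m≤m+n a (size H))) (verts-lower (a + size H) F w)

verts-upper : ∀ a F → All (_≤ a + size F) (verts a F)
verts-upper a ε = m≤m+n a 0 ∷ []
verts-upper a (edge F) = m≤m+n a _ ∷ All.map (λ {z} → subst (z ≤_) (sym (+-suc a (size F)))) (verts-upper (suc a) F)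
verts-upper a (chord H F) = m≤m+n a _ ∷
  All.map (λ {z} → subst (z ≤_) (+-assoc a (size H) (size F))) (verts-upper (a + size H) F)

verts-increasing : ∀ a {F} → WF F → Increasing (verts a F)
verts-increasing a ε = [] ∷ []
verts-increasing a (edge {G} w) = verts-lower (suc a) G w ∷ verts-increasing (suc a) w
verts-increasing a (chord {H} {G} l v w) =
  All.map (<-≤-trans (a<a+size a l v)) (verts-lower (a + size H) G w) ∷ verts-increasing (a + size H) w

allNodes : Forest → List Node
allNodes F = (0 , F) ∷ nodes 0 F

-- Chords are compared by membership only, because the list in a dissection may have any order and
-- repetitions.
record Represents {n} (F : Forest) (D : Dissection n) : Set where
  field
    wf       : WF F
    wide     : 2 ≤ len F
    total    : size F ≡ suc n
    sound    : ∀ {ν} → ν ∈ nodes 0 F → span ν ∈ chords D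
    complete : ∀ {p} → p ∈ chords D → ∃ λ ν → ν ∈ nodes 0 F × span ν ≡ p

module _ {n} {D : Dissection n} {F : Forest} (rep : Represents F D) where
  open Represents rep

  allNodes-WF : ∀ {ν} → ν ∈ allNodes F → 2 ≤ len (proj₂ ν) × WF (proj₂ ν)
  allNodes-WF (here refl) = wide , wf
  allNodes-WF (there m)   = nodes-WF wf m

  allNodes-end≤ : ∀ {ν} → ν ∈ allNodes F → end ν ≤ suc n
  allNodes-end≤ (here refl) = ≤-reflexive total
  allNodes-end≤ {ν} (there k) = subst (end ν ≤_) total (end≤ {F = F} k)

  child-node : ∀ {ν μ} → ν ∈ allNodes F → μ ∈ nodes (proj₁ ν) (proj₂ ν) → μ ∈ nodes 0 F
  child-node (here refl) k = k
  child-node (there m)   k = nodes-trans {F = F} m k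

  cell-isCell : ∀ {ν} → ν ∈ allNodes F → IsCell D (cell ν)
  cell-isCell {ν@(a , H)} m = record
    { long   = subst (2 <_) (sym (length-verts a H)) (s≤s l)
    ; sides  = λ s p → sides s (s≤s⁻¹ (subst (suc s <_) (length-verts a H) p))
    ; bottom = bottom m
    ; noDiag = λ i j p q → noDiag i j p (s≤s⁻¹ (subst (j <_) (length-verts a H) q))
    }
    where
    l = proj₁ (allNodes-WF m)
    w = proj₂ (allNodes-WF m)
    sides : ∀ s → s < len H → at (verts a H) (suc s) ≡ suc (at (verts a H) s) ⊎ side (verts a H) s ∈ chords D
    sides s p with side-view a H s p
    ... | inj₁ e       = inj₁ e
    ... | inj₂ (μ , c) = inj₂ (subst (_∈ chords D) (sym (Child-side c)) (sound (child-node m (Child-∈ c))))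
    bottom : ∀ {ν} → ν ∈ allNodes F → baseSide (cell ν) ≡ (0 , suc n) ⊎ baseSide (cell ν) ∈ chords D
    bottom (here refl) = inj₁ (trans (baseSide-cell (0 , F)) (cong (0 ,_) total))
    bottom {ν} (there k) = inj₂ (subst (_∈ chords D) (sym (baseSide-cell ν)) (sound k))
    localised : ∀ {ν μ} → ν ∈ allNodes F → μ ∈ nodes 0 F → proj₁ ν ≤ proj₁ μ → end μ ≤ end ν →
                μ ≡ ν ⊎ μ ∈ nodes (proj₁ ν) (proj₂ ν)
    localised (here refl) k _ _ = inj₂ k
    localised (there m)   k p q = localise wf k m p q
    noDiag : ∀ i j → suc i < j → j ≤ len H → ¬ (i ≡ 0 × j ≡ length (verts a H) ∸ 1) →
             ¬ ((at (verts a H) i , at (verts a H) j) ∈ chords D)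
    -- A chord between vertices of the cell is within its span, so it is either the base side,
    -- excluded by `ne`, or a node below, which spans a single side.
    noDiag i j p q ne c with complete c
    ... | μ , k , e with localised m k
          (subst (a ≤_) (sym (cong proj₁ e)) (at≥ a w i (≤-trans (<⇒≤ (<⇒≤ p)) q)))
          (subst (_≤ end ν) (sym (cong proj₂ e)) (at≤ a w j q))
    ... | inj₂ k′   = <⇒≢ p (sym (no-diagonal a w k′ (<⇒≤ p) q (cong proj₁ e) (cong proj₂ e)))
    ... | inj₁ refl = ne
          ( at-injective a w (≤-trans (<⇒≤ (<⇒≤ p)) q) z≤n (trans (sym (cong proj₁ e)) (sym (at-head a H)))
          , trans (at-injective a w q ≤-refl (trans (sym (cong proj₂ e)) (sym (at-last a H))))
                  (cong (_∸ 1) (sym (length-verts a H))))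

  cell∈cells : ∀ {ν} → ν ∈ allNodes F → cell ν ∈ cells D
  cell∈cells {a , H} m = ∈-cells⁺ D (verts-increasing a (proj₂ (allNodes-WF m)))
    (All.map (λ p → s≤s (≤-trans p (allNodes-end≤ m))) (verts-upper a H)) (cell-isCell m)

  cells⇒cell : ∀ {vs} → vs ∈ cells D → ∃ λ ν → ν ∈ allNodes F × vs ≡ cell ν
  cells⇒cell m with ∈-cells⁻ D m
  ... | i , c with IsCell.bottom c
  ... | inj₁ e = (0 , F) , here refl , cell-unique D i c (verts-increasing 0 wf) (cell-isCell (here refl))
        (trans e (sym (trans (baseSide-cell (0 , F)) (cong (0 ,_) total))))
  ... | inj₂ k with complete k
  ... | ν , k′ , e = ν , there k′ , cell-unique D i c (verts-increasing (proj₁ ν) (proj₂ (nodes-WF wf k′)))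
        (cell-isCell (there k′)) (trans (sym e) (sym (baseSide-cell ν)))

sublists-unique : ∀ {A : Set} {xs : List A} → Unique xs → Unique (sublists xs)
sublists-unique [] = [] ∷ []
sublists-unique {xs = x ∷ xs} (p ∷ ps) =
  Uniqueₚ.++⁺ (Uniqueₚ.map⁺ ∷-injectiveʳ (sublists-unique ps)) (sublists-unique ps) disjoint
  where
  disjoint : ∀ {ys} → ¬ (ys ∈ map (x ∷_) (sublists xs) × ys ∈ sublists xs)
  disjoint (m , k) with ∈-map⁻ (x ∷_) m
  ... | _ , _ , refl = All.head (sublists-All p k) refl

nodes-distinct : ∀ a {F} → WF F → AllPairs (λ μ ν → span μ ≢ span ν) (nodes a F)
nodes-distinct a ε = []
nodes-distinct a (edge w) = nodes-distinct (suc a) w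
nodes-distinct a {chord H G} (chord l v w) =
  All.tabulate outer ∷ AllPairsₚ.++⁺ (nodes-distinct a v) (nodes-distinct (a + size H) w)
    (All.tabulate λ m → All.tabulate λ k e →
      <⇒≱ (<-≤-trans (start<end v m) (end≤ {F = H} m)) (subst (a + size H ≤_) (sym (cong proj₁ e)) (start≥ {F = G} k)))
  where
  outer : ∀ {ν} → ν ∈ nodes a H ++ nodes (a + size H) G → span (a , H) ≢ span ν
  outer {ν} m e with ∈-++⁻ (nodes a H) m
  ... | inj₁ k = <⇒≢ (size-strict v l k)
        (sym (+-cancelˡ-≡ a _ _ (trans (cong proj₂ e) (cong (_+ size (proj₂ ν)) (sym (cong proj₁ e))))))
  ... | inj₂ k = <⇒≱ (a<a+size a l v) (subst (a + size H ≤_) (sym (cong proj₁ e)) (start≥ {F = G} k))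

module _ {n} {D : Dissection n} {F : Forest} (rep : Represents F D) where
  open Represents rep

  -- Both lists are free of repetitions and have the same members; different nodes give different
  -- cells because their base sides differ.
  cells-↭ : cells D ↭ map cell (allNodes F)
  cells-↭ = ∼bag⇒↭ (unique∧set⇒bag
    (subst Unique (sym (cells≡filter D))
      (Uniqueₚ.filter⁺ (T? ∘ isCellᵇ D) (sublists-unique (Uniqueₚ.upTo⁺ (suc (suc n))))))
    (AllPairsₚ.map⁺ (AllPairs.map
      (λ {μ} {ν} ne e → ne (trans (sym (baseSide-cell μ)) (trans (cong baseSide e) (baseSide-cell ν))))
      (All.tabulate (λ m e → <⇒≢ (size-strict wf wide m)
          (sym (trans (cong proj₂ e) (cong (_+ _) (sym (cong proj₁ e))))))
        ∷ nodes-distinct 0 wf)))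
    (mk⇔ (λ m → let ν , k , e = cells⇒cell rep m in subst (_∈ _) (sym e) (∈-map⁺ cell k))
         (λ m → let ν , k , e = ∈-map⁻ cell m in subst (_∈ cells D) (sym e) (cell∈cells rep k))))

-- The quiddity and the word determine each other.

count : ℕ → List (List ℕ) → ℕ
count i Cs = length (filterᵇ (elemᵇ i) Cs)

ι : Bool → ℕ
ι true  = 1
ι false = 0

count-∷ : ∀ i C Cs → count i (C ∷ Cs) ≡ ι (elemᵇ i C) + count i Cs
count-∷ i C Cs with elemᵇ i C
... | true  = refl
... | false = refl

count-++ : ∀ i Bs Cs → count i (Bs ++ Cs) ≡ count i Bs + count i Cs
count-++ i [] Cs = refl
count-++ i (B ∷ Bs) Cs with elemᵇ i B
... | true  = cong suc (count-++ i Bs Cs)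
... | false = count-++ i Bs Cs

count-↭ : ∀ i {Bs Cs} → Bs ↭ Cs → count i Bs ≡ count i Cs
count-↭ i {Bs} {Cs} p = trans (cong length (filterᵇ≡filter (elemᵇ i) Bs))
  (trans (↭-length (filter-↭ (T? ∘ elemᵇ i) p)) (sym (cong length (filterᵇ≡filter (elemᵇ i) Cs))))

ι-≡ᵇ : ∀ i a → ι (i ≡ᵇ a) ≡ δ a i
ι-≡ᵇ zero zero       = refl
ι-≡ᵇ zero (suc a)    = refl
ι-≡ᵇ (suc i) zero    = refl
ι-≡ᵇ (suc i) (suc a) = ι-≡ᵇ i a

ι-∨ : ∀ x y → (T x → ¬ T y) → ι (x ∨ y) ≡ ι x + ι y
ι-∨ true true f   = ⊥-elim (f _ _)
ι-∨ true false f  = refl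
ι-∨ false y f     = refl

elemᵇ-< : ∀ {i vs} → All (i <_) vs → ¬ T (elemᵇ i vs)
elemᵇ-< {i} {v ∷ vs} (p ∷ ps) t with to (T-∨ {i ≡ᵇ v}) t
... | inj₁ u = <⇒≢ p (≡ᵇ⇒≡ i v u)
... | inj₂ u = elemᵇ-< ps u

ι-elemᵇ : ∀ i a {vs} → All (a <_) vs → ι (elemᵇ i (a ∷ vs)) ≡ δ a i + ι (elemᵇ i vs)
ι-elemᵇ i a {vs} p = trans
  (ι-∨ (i ≡ᵇ a) (elemᵇ i vs) λ t → elemᵇ-< (subst (λ z → All (z <_) vs) (sym (≡ᵇ⇒≡ i a t)) p))
  (cong (_+ ι (elemᵇ i vs)) (ι-≡ᵇ i a))

-- The indicator function of [a , a + m].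
range : ℕ → ℕ → ℕ → ℕ
range a zero    i = δ a i
range a (suc m) i = δ a i + range (suc a) m i

-- The two intervals overlap in the vertex `a + k`, which is counted twice.
range-+ : ∀ a k m i → range a k i + range (a + k) m i ≡ δ (a + k) i + range a (k + m) i
range-+ a zero m i = cong₂ (λ x y → δ x i + range y m i) (sym (+-identityʳ a)) (+-identityʳ a)
range-+ a (suc k) m i rewrite +-suc a k = begin
  δ a i + range (suc a) k i + range (suc a + k) m i    ≡⟨ +-assoc (δ a i) _ _ ⟩
  δ a i + (range (suc a) k i + range (suc a + k) m i)  ≡⟨ cong (δ a i +_) (range-+ (suc a) k m i) ⟩
  δ a i + (δ (suc a + k) i + range (suc a) (k + m) i)  ≡⟨ +-assoc (δ a i) _ _ ⟨
  δ a i + δ (suc a + k) i + range (suc a) (k + m) i    ≡⟨ cong (_+ range (suc a) (k + m) i) (+-comm (δ a i) _) ⟩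
  δ (suc a + k) i + δ a i + range (suc a) (k + m) i    ≡⟨ +-assoc (δ (suc a + k) i) _ _ ⟩
  δ (suc a + k) i + (δ a i + range (suc a) (k + m) i)  ∎
  where open ≡-Reasoning

-- Each vertex i of a cell meets, besides that cell, one cell per chord ending at i inside it.
count-nodes : ∀ i a {F} → WF F →
  count i (map cell (nodes a F)) + ι (elemᵇ i (verts a F)) ≡ degree (word F) a i + range a (size F) i
count-nodes i a ε = trans (ι-elemᵇ i a []) (+-identityʳ (δ a i))
count-nodes i a (edge {G} w) = begin
  g + ι (elemᵇ i (a ∷ verts (suc a) G))          ≡⟨ cong (g +_) (ι-elemᵇ i a (verts-lower (suc a) G w)) ⟩
  g + (δ a i + e)                                ≡⟨ solve 3 (λ g d e → g :+ (d :+ e) := (g :+ e) :+ d) refl g (δ a i) e ⟩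
  (g + e) + δ a i                                ≡⟨ cong (_+ δ a i) (count-nodes i (suc a) w) ⟩
  (d + r) + δ a i                                ≡⟨ solve 3 (λ d r e → (d :+ r) :+ e := d :+ (e :+ r)) refl d r (δ a i) ⟩
  d + (δ a i + r)                                ∎
  where
  open ≡-Reasoning
  open +-*-Solver
  g = count i (map cell (nodes (suc a) G))
  e = ι (elemᵇ i (verts (suc a) G))
  d = degree (word G) (suc a) i
  r = range (suc a) (size G) i
count-nodes i a (chord {H} {G} l v w) = begin
  count i (verts a H ∷ map cell (nodes a H ++ nodes c G)) + ι (elemᵇ i (a ∷ verts c G))
    ≡⟨ cong₂ _+_
         (trans (count-∷ i (verts a H) _) (cong (eH +_)
           (trans (cong (count i) (map-++ cell (nodes a H) (nodes c G))) (count-++ i (map cell (nodes a H)) _))))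
         (ι-elemᵇ i a (All.map (<-≤-trans (a<a+size a l v)) (verts-lower c G w))) ⟩
  (eH + (gH + gG)) + (δ a i + eG)
    ≡⟨ solve 5 (λ eH gH gG d eG → (eH :+ (gH :+ gG)) :+ (d :+ eG) := ((gH :+ eH) :+ (gG :+ eG)) :+ d)
         refl eH gH gG (δ a i) eG ⟩
  ((gH + eH) + (gG + eG)) + δ a i
    ≡⟨ cong (_+ δ a i) (cong₂ _+_ (count-nodes i a v) (count-nodes i c w)) ⟩
  ((dH + rH) + (dG + rG)) + δ a i
    ≡⟨ solve 5 (λ dH rH dG rG d → ((dH :+ rH) :+ (dG :+ rG)) :+ d := ((d :+ dH) :+ dG) :+ (rH :+ rG))
         refl dH rH dG rG (δ a i) ⟩
  ((δ a i + dH) + dG) + (rH + rG)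
    -- The vertex c shared by the two intervals accounts for the right end of the chord; the left
    -- end is the term `δ a i` from the outer cell.
    ≡⟨ cong (((δ a i + dH) + dG) +_) (range-+ a (size H) (size G) i) ⟩
  ((δ a i + dH) + dG) + (δ c i + range a (size H + size G) i)
    ≡⟨ solve 5 (λ d dH dG dc r → ((d :+ dH) :+ dG) :+ (dc :+ r) := (d :+ (dH :+ (dc :+ dG))) :+ r)
         refl (δ a i) dH dG (δ c i) (range a (size H + size G) i) ⟩
  (δ a i + (dH + (δ c i + dG))) + range a (size H + size G) i
    ≡⟨ cong (λ z → (δ a i + z) + range a (size H + size G) i) (sym
         (trans (degree-++ (word H) (true ∷ word G) a i)
                (cong (λ k → dH + degree (true ∷ word G) (a + k) i) (edges-word H)))) ⟩
  degree (word (chord H G)) a i + range a (size H + size G) i ∎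
  where
  open ≡-Reasoning
  open +-*-Solver
  c = a + size H
  gH = count i (map cell (nodes a H))
  gG = count i (map cell (nodes c G))
  eH = ι (elemᵇ i (verts a H))
  eG = ι (elemᵇ i (verts c G))
  dH = degree (word H) a i
  dG = degree (word G) c i
  rH = range a (size H) i
  rG = range c (size G) i

applyUpTo-injective : ∀ {A : Set} (f g : ℕ → A) m → applyUpTo f m ≡ applyUpTo g m → ∀ {i} → i < m → f i ≡ g i
applyUpTo-injective f g (suc m) e {zero}  _       = ∷-injectiveˡ e
applyUpTo-injective f g (suc m) e {suc i} (s≤s p) =
  applyUpTo-injective (f ∘ suc) (g ∘ suc) m (∷-injectiveʳ e) p

incidence : ℕ → List Bool → ℕ → ℕ
incidence n w i = degree w 0 i + range 0 (suc n) i

quiddity-degree : ∀ {n} {D : Dissection n} {F} → Represents F D →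
  quiddity D ≡ map (incidence n (word F)) (upTo (suc (suc n)))
quiddity-degree {n} {D} {F} rep = map-cong pointwise (upTo (suc (suc n)))
  where
  open Represents rep
  pointwise : ∀ i → count i (cells D) ≡ incidence n (word F) i
  pointwise i = begin
    count i (cells D)                                              ≡⟨ count-↭ i (cells-↭ rep) ⟩
    count i (map cell (allNodes F))                                ≡⟨ count-∷ i (verts 0 F) _ ⟩
    ι (elemᵇ i (verts 0 F)) + count i (map cell (nodes 0 F))       ≡⟨ +-comm (ι (elemᵇ i (verts 0 F))) _ ⟩
    count i (map cell (nodes 0 F)) + ι (elemᵇ i (verts 0 F))       ≡⟨ count-nodes i 0 wf ⟩
    degree (word F) 0 i + range 0 (size F) i                       ≡⟨ cong (λ m → degree (word F) 0 i + range 0 m i) total ⟩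
    incidence n (word F) i                                         ∎
    where open ≡-Reasoning

module _ {n} {D E : Dissection n} {F G : Forest} (rD : Represents F D) (rE : Represents G E) where

  word⇒quiddity : word F ≡ word G → quiddity D ≡ quiddity E
  word⇒quiddity e = trans (quiddity-degree rD)
    (trans (cong (λ w → map (incidence n w) (upTo (suc (suc n)))) e)
           (sym (quiddity-degree rE)))

  quiddity⇒word : quiddity D ≡ quiddity E → word F ≡ word G
  quiddity⇒word e = degree-injective (word F) (word G) 0
    (trans edgesF (sym (trans (edges-word G) (Represents.total rE))))
    (λ i _ l → +-cancelʳ-≡ (range 0 (suc n) i) _ _
      (applyUpTo-injective (incidence n (word F)) (incidence n (word G)) (suc (suc n)) applied (s≤s (subst (i ≤_) edgesF l))))
    where
    edgesF : edges (word F) ≡ suc n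
    edgesF = trans (edges-word F) (Represents.total rD)
    applied : applyUpTo (incidence n (word F)) (suc (suc n))
            ≡ applyUpTo (incidence n (word G)) (suc (suc n))
    applied = trans (sym (map-upTo _ (suc (suc n))))
      (trans (sym (quiddity-degree rD)) (trans e (trans (quiddity-degree rE) (map-upTo _ (suc (suc n))))))

-- From a forest to a dissection.

realise : ∀ n {F} → WF F → 2 ≤ len F → size F ≡ suc n → Σ (Dissection n) (Represents F)
realise n {F} w l e = D , record
  { wf = w ; wide = l ; total = e
  ; sound = ∈-map⁺ span
  ; complete = λ m → let ν , k , eq = ∈-map⁻ span m in ν , k , sym eq
  }
  where
  isChord : ∀ {ν} → ν ∈ nodes 0 F → IsChord n (span ν)
  isChord {a , H} m =
      subst (_≤ a + size H) (trans (+-suc a 1) (cong suc (+-comm a 1)))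
        (+-monoʳ-≤ a (size≥2 (proj₁ (nodes-WF w m)) (proj₂ (nodes-WF w m))))
    , subst (a + size H ≤_) e (end≤ {F = F} m)
    , λ { (refl , q) → <⇒≢ (size-strict w l m) (trans q (sym e)) }
  D : Dissection n
  D = record
    { chords   = map span (nodes 0 F)
    ; valid    = Allₚ.map⁺ (All.tabulate isChord)
    ; noncross = λ p q → noncrossing (∈-map⁻ span p) (∈-map⁻ span q)
    }
    where
    noncrossing : ∀ {p q} → (∃ λ ν → ν ∈ nodes 0 F × p ≡ span ν) → (∃ λ ν → ν ∈ nodes 0 F × q ≡ span ν) → ¬ Crosses p q
    noncrossing (_ , m , refl) (_ , k , refl) = nodes-noncrossing w m k

-- From a dissection to a forest.

module _ {n} (D : Dissection n) where

  chord-gap : ∀ {x y} → (x , y) ∈ chords D → suc x < y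
  chord-gap m = proj₁ (All.lookup (valid D) m)

  -- P selects the chords to be accounted for: all of them, or all except the one spanning the
  -- interval when that one is the base side of the cell being built.
  record Fills (P : ℕ × ℕ → Set) (a m : ℕ) (F : Forest) : Set where
    field
      wf       : WF F
      total    : size F ≡ m
      sound    : ∀ {ν} → ν ∈ nodes a F → span ν ∈ chords D
      complete : ∀ {p} → P p → p ∈ chords D → a ≤ proj₁ p → proj₂ p ≤ a + m → ∃ λ ν → ν ∈ nodes a F × span ν ≡ p

  IsSide : ℕ → ℕ → Set
  IsSide a t = t ≡ 1 ⊎ (a , a + t) ∈ chords D

  -- The edge t = 1 is the default when no chord from a fits.
  longestSide : ∀ a m → ∃ λ t → 1 ≤ t × t ≤ suc m × IsSide a t × (∀ u → t < u → u ≤ suc m → ¬ ((a , a + u) ∈ chords D))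
  longestSide a zero = 1 , ≤-refl , ≤-refl , inj₁ refl , λ u p q → ⊥-elim (<⇒≱ p q)
  longestSide a (suc m) with (a , a + suc (suc m)) ∈? chords D
  ... | yes c = suc (suc m) , s≤s z≤n , ≤-refl , inj₂ c , λ u p q → ⊥-elim (<⇒≱ p q)
  ... | no ¬c with longestSide a m
  ... | t , 1≤t , t≤ , s , f = t , 1≤t , m≤n⇒m≤1+n t≤ , s , λ u p q → longer u p (m≤n⇒m<n∨m≡n q)
    where
    longer : ∀ u → t < u → u < suc (suc m) ⊎ u ≡ suc (suc m) → ¬ ((a , a + u) ∈ chords D)
    longer u p (inj₁ q)    = f u p (s≤s⁻¹ q)
    longer u p (inj₂ refl) = ¬c

  -- A chord reaching over `a + t` would start at a and beat the longest side, or start strictly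
  -- below that side and cross it.
  chord-separated : ∀ {a t m x y} → IsSide a t → (∀ u → t < u → u < m → ¬ ((a , a + u) ∈ chords D)) →
    (x , y) ≢ (a , a + m) → (x , y) ∈ chords D → a ≤ x → y ≤ a + m → y ≤ a + t ⊎ a + t ≤ x
  chord-separated {a} {t} {m} {x} {y} s f ne c p q with y ≤? a + t | a + t ≤? x
  ... | yes y≤ | _      = inj₁ y≤
  ... | no _   | yes ≤x = inj₂ ≤x
  ... | no y≰  | no ≰x  = ⊥-elim (absurd (m≤n⇒m<n∨m≡n p))
    where
    absurd : ¬ (a < x ⊎ a ≡ x)
    absurd (inj₂ refl) = f (y ∸ a)
      (+-cancelˡ-< a _ _ (subst (a + t <_) (sym a+u) (≰⇒> y≰)))
      (+-cancelˡ-< a _ _ (subst (_< a + m) (sym a+u) (≤∧≢⇒< q λ e → ne (cong (a ,_) e))))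
      (subst (λ z → (a , z) ∈ chords D) (sym a+u) c)
      where
      a+u : a + (y ∸ a) ≡ y
      a+u = m+[n∸m]≡n (≤-trans (m≤m+n a t) (<⇒≤ (≰⇒> y≰)))
    absurd (inj₁ a<x) =
      [ (λ { refl → <⇒≱ a<x (s≤s⁻¹ (subst (x <_) (+-comm a 1) (≰⇒> ≰x))) })
      , (λ c′ → noncross D c′ c (a<x , ≰⇒> ≰x , ≰⇒> y≰)) ]′ s

  -- The first tree spans the longest proper side (a , a + t) of the interval, the others fill the rest.
  fill : ∀ k a m → 2 ≤ m → m ≤ k → ∃ λ F → 2 ≤ len F × Fills (_≢ (a , a + m)) a m F
  -- The interval may itself carry a chord, which then becomes the only tree. The bound k drops at
  -- each pass through `fill`, which makes the mutual recursion terminate.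
  fillAll : ∀ k a m → 1 ≤ m → m ≤ k → ∃ λ F → 1 ≤ len F × Fills (λ _ → ⊤) a m F

  fill (suc k) a (suc zero) (s≤s ()) _
  fill (suc k) a (suc m@(suc m′)) _ (s≤s m≤k) with longestSide a m′
  ... | t , 1≤t , t≤m , s , longest = prepend s
    where
    r = suc m ∸ t
    t+r : t + r ≡ suc m
    t+r = m+[n∸m]≡n (m≤n⇒m≤1+n t≤m)
    rest = fillAll k (a + t) r (m<n⇒0<n∸m (s≤s t≤m)) (≤-trans (∸-monoʳ-≤ (suc m) 1≤t) m≤k)
    G = proj₁ rest
    module G = Fills (proj₂ (proj₂ rest))
    separated : ∀ {x y} → (x , y) ≢ (a , a + suc m) → (x , y) ∈ chords D → a ≤ x → y ≤ a + suc m → y ≤ a + t ⊎ a + t ≤ x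
    separated = chord-separated s (λ u p q → longest u p (s≤s⁻¹ q))
    inRest : ∀ {x y} → (x , y) ∈ chords D → a + t ≤ x → y ≤ a + suc m → ∃ λ ν → ν ∈ nodes (a + t) G × span ν ≡ (x , y)
    inRest {y = y} c p q = G.complete tt c p (subst (y ≤_) (trans (cong (a +_) (sym t+r)) (sym (+-assoc a t r))) q)
    prepend : IsSide a t → ∃ λ F → 2 ≤ len F × Fills (_≢ (a , a + suc m)) a (suc m) F
    prepend (inj₁ refl) = edge G , s≤s (proj₁ (proj₂ rest)) , record
      { wf       = edge G.wf
      ; total    = trans (cong suc G.total) t+r
      ; sound    = λ {ν} m → G.sound (subst (λ z → ν ∈ nodes z G) (+-comm 1 a) m)
      ; complete = λ {p} ne c p≥ p≤ → case ne c p≥ p≤ (separated ne c p≥ p≤)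
      }
      where
      case : ∀ {x y} → (x , y) ≢ (a , a + suc m) → (x , y) ∈ chords D → a ≤ x → y ≤ a + suc m →
             y ≤ a + 1 ⊎ a + 1 ≤ x → ∃ λ ν → ν ∈ nodes a (edge G) × span ν ≡ (x , y)
      case {x} {y} ne c p≥ p≤ (inj₁ q) = ⊥-elim (<⇒≱ (chord-gap c) (≤-trans q (subst (_≤ suc x) (+-comm 1 a) (s≤s p≥))))
      case ne c p≥ p≤ (inj₂ q) with inRest c q p≤
      ... | ν , k , e = ν , subst (λ z → ν ∈ nodes z G) (+-comm a 1) k , e
    prepend (inj₂ c₀) with fill k a t 2≤t (≤-trans t≤m m≤k)
      where
      2≤t : 2 ≤ t
      2≤t = +-cancelˡ-≤ a 2 t (subst (_≤ a + t) (+-comm 2 a) (chord-gap c₀))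
    ... | H , 2≤H , fH = chord H G , s≤s (proj₁ (proj₂ rest)) , record
      { wf       = chord 2≤H H.wf G.wf
      ; total    = trans (cong₂ _+_ H.total G.total) t+r
      ; sound    = sound
      ; complete = λ {p} ne c p≥ p≤ → case ne c p≥ p≤ (separated ne c p≥ p≤)
      }
      where
      module H = Fills fH
      shift : a + t ≡ a + size H
      shift = cong (a +_) (sym H.total)
      sound : ∀ {ν} → ν ∈ nodes a (chord H G) → span ν ∈ chords D
      sound (here refl) = subst (λ z → (a , z) ∈ chords D) shift c₀
      sound {ν} (there m) with ∈-++⁻ (nodes a H) m
      ... | inj₁ k = H.sound k
      ... | inj₂ k = G.sound (subst (λ z → ν ∈ nodes z G) (sym shift) k)
      case : ∀ {x y} → (x , y) ≢ (a , a + suc m) → (x , y) ∈ chords D → a ≤ x → y ≤ a + suc m →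
             y ≤ a + t ⊎ a + t ≤ x → ∃ λ ν → ν ∈ nodes a (chord H G) × span ν ≡ (x , y)
      case {x} {y} ne c p≥ p≤ (inj₁ q) with ≡-dec _≟_ _≟_ (x , y) (a , a + t)
      ... | yes e = (a , H) , here refl , trans (cong (a ,_) (sym shift)) (sym e)
      ... | no ne′ with H.complete ne′ c p≥ q
      ...   | ν , k , e = ν , there (∈-++⁺ˡ k) , e
      case ne c p≥ p≤ (inj₂ q) with inRest c q p≤
      ... | ν , k , e = ν , there (∈-++⁺ʳ (nodes a H) (subst (λ z → ν ∈ nodes z G) shift k)) , e

  fillAll k a 1 _ _ = edge ε , ≤-refl , record
    { wf       = edge ε
    ; total    = refl
    ; sound    = λ ()
    ; complete = λ {p} _ c p≥ p≤ →
        ⊥-elim (<⇒≱ (chord-gap c) (≤-trans p≤ (subst (_≤ suc (proj₁ p)) (+-comm 1 a) (s≤s p≥))))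
    }
  fillAll k a m@(suc (suc _)) _ m≤k with fill k a m (s≤s (s≤s z≤n)) m≤k
  ... | H , 2≤H , fH with (a , a + m) ∈? chords D
  ... | no ¬c = H , <⇒≤ 2≤H , record
    { wf = H.wf ; total = H.total ; sound = H.sound
    ; complete = λ _ c → H.complete (λ e → ¬c (subst (_∈ chords D) e c)) c }
    where module H = Fills fH
  ... | yes c₀ = chord H ε , ≤-refl , record
    { wf       = chord 2≤H H.wf ε
    ; total    = trans (+-identityʳ (size H)) H.total
    ; sound    = sound
    ; complete = complete
    }
    where
    module H = Fills fH
    sound : ∀ {ν} → ν ∈ nodes a (chord H ε) → span ν ∈ chords D
    sound (here refl) = subst (λ z → (a , a + z) ∈ chords D) (sym H.total) c₀
    sound (there i) with ∈-++⁻ (nodes a H) i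
    ... | inj₁ j = H.sound j
    complete : ∀ {p} → ⊤ → p ∈ chords D → a ≤ proj₁ p → proj₂ p ≤ a + m → ∃ λ ν → ν ∈ nodes a (chord H ε) × span ν ≡ p
    complete {p} _ c p≥ p≤ with ≡-dec _≟_ _≟_ p (a , a + m)
    ... | yes e = (a , H) , here refl , trans (cong (λ z → a , a + z) H.total) (sym e)
    ... | no ne with H.complete ne c p≥ p≤
    ...   | ν , j , e = ν , there (∈-++⁺ˡ j) , e

  represent : 1 ≤ n → ∃ λ F → Represents F D
  represent 1≤n with fill (suc n) 0 (suc n) (s≤s 1≤n) ≤-refl
  ... | F , 2≤F , f = F , record
    { wf = F.wf ; wide = 2≤F ; total = F.total ; sound = F.sound
    ; complete = λ c → let _ , y≤ , ne = All.lookup (valid D) c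
                       in F.complete (λ e → ne (cong proj₁ e , cong proj₂ e)) c z≤n y≤ }
    where module F = Fills f

-- Surgeries read off from positions modulo 3.

3∣⇒residue : ∀ {m} → 3 ∣ suc m → residue m ≡ 2₃
3∣⇒residue {m} d = last (residue m) (trans (toℕ₃-residue (suc m)) (n∣m⇒m%n≡0 (suc m) 3 d))
  where
  last : ∀ p → toℕ₃ (next p) ≡ 0 → p ≡ 2₃
  last 2₃ _ = refl

residue⇒3∣ : ∀ {m} → residue m ≡ 2₃ → 3 ∣ suc m
residue⇒3∣ {m} e = m%n≡0⇒n∣m (suc m) 3 (trans (sym (toℕ₃-residue (suc m))) (cong (toℕ₃ ∘ next) e))

residue⇒≥2 : ∀ {m} → residue m ≡ 2₃ → 2 ≤ m
residue⇒≥2 {suc (suc m)} _ = s≤s (s≤s z≤n)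

Good⇒residue : ∀ {F} → Good 0₃ F → residue (len F) ≡ 2₃
Good⇒residue {F} g = trans (sym (advance-residue 0 F)) (Good-advance g)

AllGood⇒WF : ∀ {F} → AllGood F → WF F
Good⇒WF : ∀ {p F} → Good p F → WF F
AllGood⇒WF ε           = ε
AllGood⇒WF (edge g)    = edge (AllGood⇒WF g)
AllGood⇒WF (chord h g) = chord (residue⇒≥2 (Good⇒residue h)) (Good⇒WF h) (AllGood⇒WF g)
Good⇒WF ε             = ε
Good⇒WF (edge g)      = edge (Good⇒WF g)
Good⇒WF (chord _ h g) = chord (residue⇒≥2 (Good⇒residue h)) (Good⇒WF h) (Good⇒WF g)

AllGood-node : ∀ {a F ν} → AllGood F → ν ∈ nodes a F → Good 0₃ (proj₂ ν)
Good-node : ∀ {a p F ν} → Good p F → ν ∈ nodes a F → Good 0₃ (proj₂ ν)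
AllGood-node (edge g) m = AllGood-node g m
AllGood-node (chord h g) (here refl) = h
AllGood-node {a} (chord {H} h g) (there m) with ∈-++⁻ (nodes a H) m
... | inj₁ k = Good-node h k
... | inj₂ k = AllGood-node g k
Good-node (edge g) m = Good-node g m
Good-node (chord _ h g) (here refl) = h
Good-node {a} (chord {H = H} _ h g) (there m) with ∈-++⁻ (nodes a H) m
... | inj₁ k = Good-node h k
... | inj₂ k = Good-node g k

-- The sides at positions ≡ 2 mod 3 are those with the index of the base side.
NoSurgery : Node → Set
NoSurgery (a , H) = ∀ {s ν} → Child a H s ν → residue s ≢ 2₃

Good⇒NoSurgery : ∀ {a k F s ν} → Good (residue k) F → Child a F s ν → residue (k + s) ≢ 2₃
Good⇒NoSurgery {k = k} (chord p _ _) first e = p (trans (cong residue (sym (+-identityʳ k))) e)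
Good⇒NoSurgery {k = k} (edge g) (pastEdge {s = s} c) e =
  Good⇒NoSurgery {k = suc k} g c (trans (cong residue (sym (+-suc k s))) e)
Good⇒NoSurgery {k = k} (chord _ _ g) (pastChord {s = s} c) e =
  Good⇒NoSurgery {k = suc k} g c (trans (cong residue (sym (+-suc k s))) e)

NoSurgery⇒Good : ∀ a k F → residue (k + len F) ≡ 2₃ →
  (∀ {s ν} → Child a F s ν → residue (k + s) ≢ 2₃) →
  (∀ {ν} → ν ∈ nodes a F → residue (len (proj₂ ν)) ≡ 2₃ × NoSurgery ν) → Good (residue k) F
NoSurgery⇒Good a k ε e c h = subst (λ p → Good p ε) (sym (trans (cong residue (sym (+-identityʳ k))) e)) ε
NoSurgery⇒Good a k (edge G) e c h = edge (NoSurgery⇒Good (suc a) (suc k) G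
  (trans (cong residue (sym (+-suc k (len G)))) e)
  (λ {s} x q → c (pastEdge x) (trans (cong residue (+-suc k s)) q)) h)
NoSurgery⇒Good a k (chord H G) e c h = chord
  (λ q → c first (trans (cong residue (+-identityʳ k)) q))
  (NoSurgery⇒Good a 0 H (proj₁ (h (here refl))) (proj₂ (h (here refl))) (λ m → h (there (∈-++⁺ˡ m))))
  (NoSurgery⇒Good (a + size H) (suc k) G
    (trans (cong residue (sym (+-suc k (len G)))) e)
    (λ {s} x q → c (pastChord x) (trans (cong residue (+-suc k s)) q))
    (λ m → h (there (∈-++⁺ʳ (nodes a H) m))))

NoSurgery⇒AllGood : ∀ a F →
  (∀ {ν} → ν ∈ nodes a F → residue (len (proj₂ ν)) ≡ 2₃ × NoSurgery ν) → AllGood F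
NoSurgery⇒AllGood a ε h = ε
NoSurgery⇒AllGood a (edge G) h = edge (NoSurgery⇒AllGood (suc a) G h)
NoSurgery⇒AllGood a (chord H G) h = chord
  (NoSurgery⇒Good a 0 H (proj₁ (h (here refl))) (proj₂ (h (here refl))) (λ m → h (there (∈-++⁺ˡ m))))
  (NoSurgery⇒AllGood (a + size H) G (λ m → h (there (∈-++⁺ʳ (nodes a H) m))))

nodes⇒Periodic : ∀ a F → (∀ {ν} → ν ∈ nodes a F → residue (len (proj₂ ν)) ≡ 2₃) → Periodic F
nodes⇒Periodic a ε h = ε
nodes⇒Periodic a (edge G) h = edge (nodes⇒Periodic (suc a) G h)
nodes⇒Periodic a (chord H G) h = chord (trans (advance-residue 0 H) (h (here refl)))
  (nodes⇒Periodic a H (λ m → h (there (∈-++⁺ˡ m))))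
  (nodes⇒Periodic (a + size H) G (λ m → h (there (∈-++⁺ʳ (nodes a H) m))))

-- Cancelling c leaves s + 1 divisible by 3; the equation itself forces c < 3, which leaves three
-- cases.
index-fixed⇒ : ∀ c s → c ≡ (c + s + 1) % 3 → residue s ≡ 2₃
index-fixed⇒ c s e = go c (trans (trans (toℕ₃-residue (suc (c + s))) (cong (_% 3) (+-comm 1 (c + s)))) (sym e))
                       (subst (_< 3) (sym e) (m%n<n (c + s + 1) 3))
  where
  go : ∀ c → toℕ₃ (residue (suc (c + s))) ≡ c → c < 3 → residue s ≡ 2₃
  go 0 e _ = last (residue s) e
    where
    last : ∀ p → toℕ₃ (next p) ≡ 0 → p ≡ 2₃
    last 2₃ _ = refl
  go 1 e _ = last (residue s) e
    where
    last : ∀ p → toℕ₃ (next (next p)) ≡ 1 → p ≡ 2₃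
    last 2₃ _ = refl
  go 2 e _ = last (residue s) e
    where
    last : ∀ p → toℕ₃ (next (next (next p))) ≡ 2 → p ≡ 2₃
    last 2₃ _ = refl
  go (suc (suc (suc c))) e (s≤s (s≤s (s≤s ())))

⇒index-fixed : ∀ c s → c < 3 → residue s ≡ 2₃ → (c + s + 1) % 3 ≡ c
⇒index-fixed c s l e = trans (trans (cong (_% 3) (+-comm (c + s) 1)) (sym (toℕ₃-residue (suc (c + s))))) (go c l)
  where
  go : ∀ c → c < 3 → toℕ₃ (residue (suc (c + s))) ≡ c
  go 0 _ = cong (toℕ₃ ∘ next) e
  go 1 _ = cong (toℕ₃ ∘ next ∘ next) e
  go 2 _ = cong (toℕ₃ ∘ next ∘ next ∘ next) e
  go (suc (suc (suc c))) (s≤s (s≤s (s≤s ())))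

module _ {n} {D : Dissection n} {F : Forest} (rep : Represents F D) where
  open Represents rep

  <length-cell : ∀ {s} ν → s < length (cell ν) ∸ 1 → s < len (proj₂ ν)
  <length-cell (a , H) = subst (λ k → _ < k ∸ 1) (length-verts a H)

  length-cell> : ∀ {s} ν → s < len (proj₂ ν) → s < length (cell ν) ∸ 1
  length-cell> (a , H) = subst (λ k → _ < k ∸ 1) (sym (length-verts a H))

  -- Such a side would span its whole cell. This keeps the constructors `base` and `step` from
  -- indexing the same pair.
  side≢bottom : ∀ {C s} → C ∈ cells D → s < length C ∸ 1 → side C s ≢ (0 , suc n)
  side≢bottom {s = s} m l e with cells⇒cell rep m
  ... | ν@(a , H) , k , refl = side-proper a w l₂ s< (eqˡ , eqʳ)
    where
    l₂ = proj₁ (allNodes-WF rep k)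
    w = proj₂ (allNodes-WF rep k)
    s< = <length-cell ν l
    eqˡ : at (verts a H) s ≡ a
    eqˡ = ≤-antisym (subst (_≤ a) (sym (cong proj₁ e)) z≤n) (at≥ a w s (<⇒≤ s<))
    eqʳ : at (verts a H) (suc s) ≡ a + size H
    eqʳ = ≤-antisym (at≤ a w (suc s) s<) (subst (a + size H ≤_) (sym (cong proj₂ e)) (allNodes-end≤ rep k))

  Idx-unique : ∀ {p q c d} → Idx D p c → Idx D q d → p ≡ q → c ≡ d
  Idx-unique base base e = refl
  Idx-unique base (step m _ l) e = ⊥-elim (side≢bottom m l (sym e))
  Idx-unique (step m _ l) base e = ⊥-elim (side≢bottom m l e)
  Idx-unique (step {s = s} m i l) (step m′ i′ l′) e with cells⇒cell rep m | cells⇒cell rep m′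
  ... | ν , k , refl | ν′ , k′ , refl
    with parent-unique wf wide k k′ (<length-cell ν l) (<length-cell ν′ l′) e
  ... | refl , refl = cong (λ c → (c + s + 1) % 3) (Idx-unique i i′ refl)

  -- The bound makes c a remainder, as `⇒index-fixed` requires.
  Indexed : ℕ × ℕ → Set
  Indexed p = ∃ λ c → c < 3 × Idx D p c

  child-indexed : ∀ {ν s μ} → ν ∈ allNodes F → Indexed (span ν) → Child (proj₁ ν) (proj₂ ν) s μ → Indexed (span μ)
  child-indexed {ν} {s} m (c , _ , i) x = (c + s + 1) % 3 , m%n<n (c + s + 1) 3 ,
    subst (λ p → Idx D p ((c + s + 1) % 3)) (Child-side x)
      (step (cell∈cells rep m) (subst (λ p → Idx D p c) (sym (baseSide-cell ν)) i) (length-cell> ν (Child-< x)))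

  nodes-indexed : ∀ a G → (∀ {ν} → ν ∈ nodes a G → ν ∈ nodes 0 F) →
    (∀ {s ν} → Child a G s ν → Indexed (span ν)) → ∀ {μ} → μ ∈ nodes a G → Indexed (span μ)
  nodes-indexed a (edge G) sub f m = nodes-indexed (suc a) G sub (f ∘ pastEdge) m
  nodes-indexed a (chord H G) sub f (here refl) = f first
  nodes-indexed a (chord H G) sub f (there m) with ∈-++⁻ (nodes a H) m
  ... | inj₁ k = nodes-indexed a H (λ i → sub (there (∈-++⁺ˡ i)))
                   (child-indexed (there (sub (here refl))) (f first)) k
  ... | inj₂ k = nodes-indexed (a + size H) G (λ i → sub (there (∈-++⁺ʳ (nodes a H) i))) (f ∘ pastChord) k

  indexed : ∀ {μ} → μ ∈ nodes 0 F → Indexed (span μ)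
  indexed = nodes-indexed 0 F id
    (child-indexed (here refl) (0 , s≤s z≤n , subst (λ m → Idx D (0 , m) 0) (sym total) base))

  ThreePeriodic⇒ : ThreePeriodic D → ∀ {ν} → ν ∈ allNodes F → residue (len (proj₂ ν)) ≡ 2₃
  ThreePeriodic⇒ t {a , H} m = 3∣⇒residue (subst (3 ∣_) (length-verts a H) (All.lookup t (cell∈cells rep m)))

  ⇒ThreePeriodic : (∀ {ν} → ν ∈ allNodes F → residue (len (proj₂ ν)) ≡ 2₃) → ThreePeriodic D
  ⇒ThreePeriodic h = All.tabulate λ m → periodic (cells⇒cell rep m)
    where
    periodic : ∀ {C} → (∃ λ ν → ν ∈ allNodes F × C ≡ cell ν) → 3 ∣ length C
    periodic ((a , H) , k , refl) = subst (3 ∣_) (sym (length-verts a H)) (residue⇒3∣ (h k))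

  -- Distance follows from the congruences: s and the number of non-base sides are both 2 modulo 3,
  -- so s is at least 2 and at least 3 below that number.
  surgery : ∀ {ν s μ} → ν ∈ nodes 0 F → residue (len (proj₂ ν)) ≡ 2₃ →
            Child (proj₁ ν) (proj₂ ν) s μ → residue s ≡ 2₃ → AdmitsSurgery D (cell ν)
  surgery {ν@(a , H)} {s} {μ} m rH x rs with indexed m
  ... | c , c<3 , i rewrite length-verts a H =
    s , subst (s <_) (sym r+1) (Child-< x)
      , (subst (s + 3 ≤_) (sym r+1) s+3≤ , bound)
      , subst (_∈ chords D) (sym (cong₂ _,_ (at-head a H) (at-last a H))) (sound m)
      , subst (_∈ chords D) (sym (Child-side x)) (sound (nodes-trans {F = F} m (Child-∈ x)))
      , c , subst (λ p → Idx D p c) (sym (cong₂ _,_ (at-head a H) (at-last a H))) i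
      , subst (Idx D (side (verts a H) s)) (⇒index-fixed c s c<3 rs) side-index
    where
    L = len H
    2≤L : 2 ≤ L
    2≤L = residue⇒≥2 rH
    r+1 : L ∸ 1 + 1 ≡ L
    r+1 = m∸n+n≡m (<⇒≤ 2≤L)
    s+3≤ : s + 3 ≤ L
    s+3≤ = subst (_≤ L) (+-comm 3 s) (gap (Child-< x) rs rH)
      where
      gap : ∀ {i j} → i < j → residue i ≡ 2₃ → residue j ≡ 2₃ → 3 + i ≤ j
      gap {i} {j} p e f with m≤n⇒m<n∨m≡n p
      ... | inj₂ refl with () ← trans (sym f) (cong next e)
      ... | inj₁ q with m≤n⇒m<n∨m≡n q
      ...   | inj₂ refl with () ← trans (sym f) (cong (next ∘ next) e)
      ...   | inj₁ q′ = q′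
    bound : L ∸ 1 + 1 + 3 ≤ s + (L ∸ 1 + 2)
    bound = subst (_≤ s + (L ∸ 1 + 2))
      (trans (+-comm 2 (L ∸ 1 + 2)) (trans (+-assoc (L ∸ 1) 2 2) (sym (+-assoc (L ∸ 1) 1 3))))
      (+-monoˡ-≤ (L ∸ 1 + 2) (residue⇒≥2 {s} rs))
    side-index : Idx D (side (verts a H) s) ((c + s + 1) % 3)
    side-index = step (cell∈cells rep (there m)) (subst (λ p → Idx D p c) (sym (baseSide-cell ν)) i)
                   (length-cell> ν (Child-< x))

  surgery-free : ∀ {ν} → ν ∈ nodes 0 F → NoSurgery ν → ¬ AdmitsSurgery D (cell ν)
  surgery-free {ν@(a , H)} m h (s , s< , _ , _ , c∈ , c , ib , is) with side-view a H s s<len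
    where
    s<len : s < len H
    s<len = subst (s <_) (trans (cong (λ k → k ∸ 2 + 1) (length-verts a H))
                                (m∸n+n≡m (<⇒≤ (proj₁ (nodes-WF wf m))))) s<
  ... | inj₁ e = <⇒≢ (chord-gap D c∈) (sym e)
  ... | inj₂ (μ , x) = h x (index-fixed⇒ c s
          (Idx-unique is (step (cell∈cells rep (there m)) ib (length-cell> ν (Child-< x))) refl))

  MaximallyOpen⇒AllGood : MaximallyOpen D → AllGood F
  MaximallyOpen⇒AllGood (t , o) = NoSurgery⇒AllGood 0 F λ {ν} m →
    ThreePeriodic⇒ t (there m) ,
    λ x e → All.lookup o (cell∈cells rep (there m)) (surgery m (ThreePeriodic⇒ t (there m)) x e)

  AllGood⇒MaximallyOpen : AllGood F → residue (len F) ≡ 2₃ → MaximallyOpen D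
  AllGood⇒MaximallyOpen g e = ⇒ThreePeriodic periodic , All.tabulate λ m → closed (cells⇒cell rep m)
    where
    periodic : ∀ {ν} → ν ∈ allNodes F → residue (len (proj₂ ν)) ≡ 2₃
    periodic (here refl) = e
    periodic (there m)   = Good⇒residue (AllGood-node g m)
    closed : ∀ {C} → (∃ λ ν → ν ∈ allNodes F × C ≡ cell ν) → ¬ AdmitsSurgery D C
    -- A surgery would need the base edge to be a chord, which `IsChord` rules out.
    closed (_ , here refl , refl) (_ , _ , _ , b∈ , _) = proj₂ (proj₂ (All.lookup (valid D) b∈))
      (at-head 0 F , trans (cong proj₂ (baseSide-cell (0 , F))) total)
    closed (ν , there m , refl) = surgery-free m (Good⇒NoSurgery {k = 0} (AllGood-node g m))

-- Existence and uniqueness.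

SameChords-forest : ∀ {n} {D E : Dissection n} {F} → Represents F D → Represents F E → SameChords D E
SameChords-forest rD rE p = mk⇔ (transfer rD rE) (transfer rE rD)
  where
  transfer : ∀ {n} {D E : Dissection n} {F} → Represents F D → Represents F E → ∀ {p} → p ∈ chords D → p ∈ chords E
  transfer rD rE m with Represents.complete rD m
  ... | ν , k , refl = Represents.sound rE k

opening : ∀ {n} {D : Dissection n} {F} → Represents F D → ThreePeriodic D →
  ∃₂ λ G E → Represents {n} G E × AllGood G × residue (len G) ≡ 2₃ × word G ≡ word F
opening {n} {D} {F} rD t = G , E , rE , good , periodic , fullyOpen-word F
  where
  open ≡-Reasoning
  G : Forest
  G = fullyOpen F
  opened : AllGood G × (∀ p → advance p G ≡ advance p F)
  opened = fullyOpen-good (nodes⇒Periodic 0 F (λ m → ThreePeriodic⇒ rD t (there m)))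
  good : AllGood G
  good = proj₁ opened
  periodic : residue (len G) ≡ 2₃
  periodic = begin
    residue (len G)  ≡⟨ advance-residue 0 G ⟨
    advance 0₃ G     ≡⟨ proj₂ opened 0₃ ⟩
    advance 0₃ F     ≡⟨ advance-residue 0 F ⟩
    residue (len F)  ≡⟨ ThreePeriodic⇒ rD t (here refl) ⟩
    2₃               ∎
  -- Size counts the letters `false`, so it is inherited through the equality of words.
  size-G : size G ≡ suc n
  size-G = begin
    size G          ≡⟨ edges-word G ⟨
    edges (word G)  ≡⟨ cong edges (fullyOpen-word F) ⟩
    edges (word F)  ≡⟨ edges-word F ⟩
    size F          ≡⟨ Represents.total rD ⟩
    suc n           ∎
  realised : Σ (Dissection n) (Represents G)
  realised = realise n (AllGood⇒WF good) (residue⇒≥2 periodic) size-G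
  E : Dissection n
  E = proj₁ realised
  rE : Represents G E
  rE = proj₂ realised

MaximallyOpen-unique : ∀ {n} {E E′ : Dissection n} {G G′} → Represents G E → Represents G′ E′ →
  AllGood G → MaximallyOpen E′ → quiddity E′ ≡ quiddity E → SameChords E′ E
MaximallyOpen-unique rE rE′ good o q
  with word-injective (MaximallyOpen⇒AllGood rE′ o) good (quiddity⇒word rE′ rE q)
... | refl = SameChords-forest rE′ rE

theorem6p20 : (n : ℕ) → 1 ≤ n → (D : Dissection n) → ThreePeriodic D →
    Σ (Dissection n) λ E → MaximallyOpen E × (quiddity E ≡ quiddity D)
    × ((E′ : Dissection n) → MaximallyOpen E′ → quiddity E′ ≡ quiddity D → SameChords E′ E)
theorem6p20 n 1≤n D t =
  let F , rD = represent D 1≤n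
      G , E , rE , good , periodic , same-word = opening rD t
      same-quiddity = word⇒quiddity rE rD same-word
  in E , AllGood⇒MaximallyOpen rE good periodic , same-quiddity ,
     λ E′ o q → MaximallyOpen-unique rE (proj₂ (represent E′ 1≤n)) good o (trans q (sym same-quiddity))
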